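{- In IITT: (1) the relation $\Gamma\vdash t=t':T$ (as a relation on $\Gamma,t,t',T$) is decidable; (2) the relation $\Gamma\vdash t:T$ is decidable.
   Context: Irrelevant Intensional Type Theory (IITT) is defined as follows. Sorts are $\mathsf{Set}_k$ ($k\in\mathbb{N}$), with $\mathsf{Axiom}=\{(\mathsf{Set}_i,\mathsf{Set}_{i+1})\mid i\in\mathbb{N}\}$ and $\mathsf{Rule}=\{(\mathsf{Set}_i,\mathsf{Set}_j,\mathsf{Set}_{\max(i,j)})\mid i,j\in\mathbb{N}\}$. Annotations are $\star\in\{:,\div\}$ (relevant, irrelevant). Expressions: $t,u,T,U ::= s \mid (x\star U)\to^{s,s'}T \mid x \mid \lambda x\star U.\,t \mid t\star u$, where $(x\star U)\to^{s,s'}T$ is a relevant or irrelevant dependent function type annotated with the sort $s$ of its domain and $s'$ of its codomain, and $t\star u$ is relevant application (also written $t\,u$) or irrelevant application $t\div u$. Expressions are taken modulo $\alpha$-equivalence; $[u/x]t$ is capture-avoiding substitution. Contexts: $\Gamma ::= () \mid \Gamma.\,x\star T$ (variables distinct). Resurrection $\Gamma^{\oplus}$ replaces each binding $x\div T$ by $x:T$. Abbreviations: $\Gamma\vdash t\div T$ means $\Gamma^\oplus\vdash t:T$; $\Gamma\vdash t=t'\div T$ means $\Gamma\vdash t\div T$ and $\Gamma\vdash t'\div T$; $\Gamma\vdash T$ means $\Gamma\vdash T:s$ for some sort $s$; $\Gamma\vdash T=T'$ means $\Gamma\vdash T=T':s$ for some $s$. The judgements $\vdash\Gamma$, $\Gamma\vdash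 t:T$, $\Gamma\vdash t=t':T$ are defined mutually inductively by: (contexts) $\vdash()$; from $\vdash\Gamma$ and $\Gamma\vdash T$ infer $\vdash\Gamma.x\star T$. (typing) from $\vdash\Gamma$, $(s,s')\in\mathsf{Axiom}$ infer $\Gamma\vdash s:s'$; from $\Gamma\vdash U:s_1$, $\Gamma.x\star U\vdash T:s_2$, $(s_1,s_2,s_3)\in\mathsf{Rule}$ infer $\Gamma\vdash (x\star U)\to^{s_1,s_2}T:s_3$; from $\vdash\Gamma$ and $(x:U)\in\Gamma$ infer $\Gamma\vdash x:U$ (no variable rule for irrelevant bindings); from $\Gamma.x\star U\vdash t:T$ and $\Gamma\vdash (x\star U)\to^{s,s'}T$ infer $\Gamma\vdash \lambda x\star U.t:(x\star U)\to^{s,s'}T$; from $\Gamma\vdash t:(x\star U)\to^{s,s'}T$ and $\Gamma\vdash u\star U$ infer $\Gamma\vdash t\star u:[u/x]T$; from $\Gamma\vdash t:T$ and $\Gamma\vdash T=T'$ infer $\Gamma\vdash t:T'$. (equality) $\beta$: from $\Gamma.x\star U\vdash t:T$ and $\Gamma\vdash u\star U$ infer $\Gamma\vdash(\lambda x\star U.t)\star u=[u/x]t:[u/x]T$; $\eta$: from $\Gamma\vdash t:(x\star U)\to^{s,s'}T$ infer $\Gamma\vdash t=\lambda x\star U.(t\star x):(x\star U)\to^{s,s'}T$; reflexivity, symmetry, transitivity; from $\Gamma\vdash U=U':s_1$, $\Gamma.x\star U\vdash T=T':s_2$, $(s_1,s_2,s_3)\in\mathsf{Rule}$ infer $\Gamma\vdash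 (x\star U)\to^{s_1,s_2}T=(x\star U')\to^{s_1,s_2}T':s_3$; from $\Gamma\vdash U=U':s_1$, $\Gamma.x\star U\vdash T:s_2$, $\Gamma.x\star U\vdash t=t':T$ infer $\Gamma\vdash\lambda x\star U.t=\lambda x\star U'.t':(x\star U)\to^{s_1,s_2}T$; from $\Gamma\vdash t=t':(x\star U)\to^{s,s'}T$ and $\Gamma\vdash u=u'\star U$ infer $\Gamma\vdash t\star u=t'\star u':[u/x]T$; from $\Gamma\vdash t=t':T$ and $\Gamma\vdash T=T'$ infer $\Gamma\vdash t=t':T'$. -}

module Defs where

-- Irrelevant Intensional Type Theory (IITT), syntax with de Bruijn indices
-- (so expressions are automatically taken modulo alpha-equivalence and
-- context variables are automatically distinct).

open import Data.Nat using (ℕ; zero; suc; _⊔_)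
open import Data.Product using (_×_; _,_)

data Ann : Set where
  rel irr : Ann

data Exp : Set where
  sort : ℕ → Exp
  pi   : Ann → ℕ → ℕ → Exp → Exp → Exp    -- pi ★ s s' U T  =  (x ★ U) →^{Set_s, Set_s'} T   (T binds x)
  var  : ℕ → Exp
  lam  : Ann → Exp → Exp → Exp            -- lam ★ U t  =  λ x ★ U. t   (t binds x)
  app  : Ann → Exp → Exp → Exp

liftRen : (ℕ → ℕ) → ℕ → ℕ
liftRen ρ zero    = zero
liftRen ρ (suc n) = suc (ρ n)

rename : (ℕ → ℕ) → Exp → Exp
rename ρ (sort k)       = sort k
rename ρ (pi a s s' U T) = pi a s s' (rename ρ U) (rename (liftRen ρ) T)
rename ρ (var n)        = var (ρ n)
rename ρ (lam a U t)    = lam a (rename ρ U) (rename (liftRen ρ) t)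
rename ρ (app a t u)    = app a (rename ρ t) (rename ρ u)

wk : Exp → Exp
wk = rename suc

liftSub : (ℕ → Exp) → ℕ → Exp
liftSub σ zero    = var zero
liftSub σ (suc n) = wk (σ n)

subst : (ℕ → Exp) → Exp → Exp
subst σ (sort k)        = sort k
subst σ (pi a s s' U T) = pi a s s' (subst σ U) (subst (liftSub σ) T)
subst σ (var n)         = σ n
subst σ (lam a U t)     = lam a (subst σ U) (subst (liftSub σ) t)
subst σ (app a t u)     = app a (subst σ t) (subst σ u)

single : Exp → ℕ → Exp
single u zero    = u
single u (suc n) = var n

_[_] : Exp → Exp → Exp
t [ u ] = subst (single u) t

data Ctx : Set where
  ε   : Ctx
  _▸_ : Ctx → Ann × Exp → Ctx

infixl 5 _▸_

_⊕ : Ctx → Ctx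
ε ⊕ = ε
(Γ ▸ (a , T)) ⊕ = (Γ ⊕) ▸ (rel , T)


data _∋_∶_ : Ctx → ℕ → Exp → Set where
  here  : ∀ {Γ U} → (Γ ▸ (rel , U)) ∋ zero ∶ wk U
  there : ∀ {Γ n U b B} → Γ ∋ n ∶ U → (Γ ▸ (b , B)) ∋ suc n ∶ wk U

infix 4 ⊢_ _⊢_∶_ _⊢_≡_∶_ _⊢_∶[_]_ _⊢_≡_∶[_]_ _∋_∶_

mutual
  data ⊢_ : Ctx → Set where
    ctx-ε : ⊢ ε
    ctx-▸ : ∀ {Γ a T k} → ⊢ Γ → Γ ⊢ T ∶ sort k → ⊢ (Γ ▸ (a , T))

  data _⊢_∶[_]_ : Ctx → Exp → Ann → Exp → Set where
    ann-rel : ∀ {Γ u U} → Γ ⊢ u ∶ U → Γ ⊢ u ∶[ rel ] U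
    ann-irr : ∀ {Γ u U} → (Γ ⊕) ⊢ u ∶ U → Γ ⊢ u ∶[ irr ] U

  data _⊢_≡_∶[_]_ : Ctx → Exp → Exp → Ann → Exp → Set where
    eqann-rel : ∀ {Γ u u' U} → Γ ⊢ u ≡ u' ∶ U → Γ ⊢ u ≡ u' ∶[ rel ] U
    eqann-irr : ∀ {Γ u u' U} → (Γ ⊕) ⊢ u ∶ U → (Γ ⊕) ⊢ u' ∶ U → Γ ⊢ u ≡ u' ∶[ irr ] U

  data _⊢_∶_ : Ctx → Exp → Exp → Set where
    ty-sort : ∀ {Γ i} → ⊢ Γ → Γ ⊢ sort i ∶ sort (suc i)
    ty-pi   : ∀ {Γ a U T i j} → Γ ⊢ U ∶ sort i → (Γ ▸ (a , U)) ⊢ T ∶ sort j →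
              Γ ⊢ pi a i j U T ∶ sort (i ⊔ j)
    ty-var  : ∀ {Γ x U} → ⊢ Γ → Γ ∋ x ∶ U → Γ ⊢ var x ∶ U
    ty-lam  : ∀ {Γ a U T t s s' k} → (Γ ▸ (a , U)) ⊢ t ∶ T →
              Γ ⊢ pi a s s' U T ∶ sort k →
              Γ ⊢ lam a U t ∶ pi a s s' U T
    ty-app  : ∀ {Γ a U T t u s s'} → Γ ⊢ t ∶ pi a s s' U T → Γ ⊢ u ∶[ a ] U →
              Γ ⊢ app a t u ∶ (T [ u ])
    ty-conv : ∀ {Γ t T T' k} → Γ ⊢ t ∶ T → Γ ⊢ T ≡ T' ∶ sort k → Γ ⊢ t ∶ T'

  data _⊢_≡_∶_ : Ctx → Exp → Exp → Exp → Set where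
    eq-β     : ∀ {Γ a U T t u} → (Γ ▸ (a , U)) ⊢ t ∶ T → Γ ⊢ u ∶[ a ] U →
               Γ ⊢ app a (lam a U t) u ≡ (t [ u ]) ∶ (T [ u ])
    eq-η     : ∀ {Γ a U T t s s'} → Γ ⊢ t ∶ pi a s s' U T →
               Γ ⊢ t ≡ lam a U (app a (wk t) (var zero)) ∶ pi a s s' U T
    eq-refl  : ∀ {Γ t T} → Γ ⊢ t ∶ T → Γ ⊢ t ≡ t ∶ T
    eq-sym   : ∀ {Γ t t' T} → Γ ⊢ t ≡ t' ∶ T → Γ ⊢ t' ≡ t ∶ T
    eq-trans : ∀ {Γ t t' t'' T} → Γ ⊢ t ≡ t' ∶ T → Γ ⊢ t' ≡ t'' ∶ T → Γ ⊢ t ≡ t'' ∶ T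
    eq-pi    : ∀ {Γ a U U' T T' i j} → Γ ⊢ U ≡ U' ∶ sort i →
               (Γ ▸ (a , U)) ⊢ T ≡ T' ∶ sort j →
               Γ ⊢ pi a i j U T ≡ pi a i j U' T' ∶ sort (i ⊔ j)
    eq-lam   : ∀ {Γ a U U' T t t' i j} → Γ ⊢ U ≡ U' ∶ sort i →
               (Γ ▸ (a , U)) ⊢ T ∶ sort j →
               (Γ ▸ (a , U)) ⊢ t ≡ t' ∶ T →
               Γ ⊢ lam a U t ≡ lam a U' t' ∶ pi a i j U T
    eq-app   : ∀ {Γ a U T t t' u u' s s'} → Γ ⊢ t ≡ t' ∶ pi a s s' U T →
               Γ ⊢ u ≡ u' ∶[ a ] U →
               Γ ⊢ app a t u ≡ app a t' u' ∶ (T [ u ])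
    eq-conv  : ∀ {Γ t t' T T' k} → Γ ⊢ t ≡ t' ∶ T → Γ ⊢ T ≡ T' ∶ sort k →
               Γ ⊢ t ≡ t' ∶ T'

{-# OPTIONS --safe #-}
module Submission where

-- Untyped weak head reduction is related to the judgements by a Kripke logical relation: reducible types (Ty),
-- their equality (TyEq) and the partial equivalence relation on their elements (El), defined by
-- induction-recursion over the universe hierarchy. Worlds are contexts under renamings that may also resurrect
-- variables, and two irrelevant arguments are related as soon as both are reducible after resurrection.
-- Related neutral terms carry a common normal form, which is untyped, η-contracted, and erases irrelevant
-- arguments and domains of abstractions. The fundamental theorem then yields, for the identity substitution,
-- injectivity of function types, subject reduction, uniqueness of types, and that equal terms have the same
-- normal form. Conversely, well-typed terms of the same type with the same normal form are equal, so equality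
-- is decided by comparing normal forms, and typing by inferring types.

open import Defs
open import Data.Bool using (Bool; true; false; _∨_)
open import Data.Bool.Properties using (∨-conicalˡ; ∨-conicalʳ)
open import Data.Empty using (⊥; ⊥-elim)
open import Data.Nat using (ℕ; zero; suc; pred; _+_; _⊔_; _≤_; _<_; s≤s)
open import Data.Nat.Induction using (<-wellFounded)
import Data.Nat.Properties as ℕₚ
open import Data.Nat.Tactic.RingSolver using (solve-∀)
open import Data.Product using (Σ; ∃; _×_; _,_; proj₁; proj₂)
open import Data.Sum using (inj₁; inj₂)
open import Function using (_∘_; id)
open import Induction.WellFounded using (Acc; acc)
open import Relation.Binary.PropositionalEquality
  using (refl; sym; trans; cong; cong₂) renaming (_≡_ to _≐_; subst to transport)
open import Relation.Nullary using (Dec; yes; no; ¬_)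

-- Transitivity dictates the shape of the relation on neutral terms. Two neutral terms may be
-- related at one type and again at another, and the types of their subterms cannot be compared
-- before injectivity of function types is known. Asking for a common untyped normal form turns
-- transitivity into determinism (`nf-det`). Such a normal form must not consult the type, so η is
-- handled by contraction instead of type-directed expansion. It also cannot mention the domain
-- written on an abstraction, about which `El` at a function type says nothing; the domain is
-- recovered by injectivity from the type at which terms are finally compared.
--
-- Irrelevant application is what brings resurrection into the worlds: its argument lives in `Γ ⊕`,
-- while the application and its type `T [ u ]` stay in `Γ`. A reducible function type over `Γ`
-- therefore has to interpret its domain in both contexts.

variable
  a a' b             : Ann
  i i' j j' k l      : ℕ
  ρ ρ'               : ℕ → ℕ
  σ σ' σ″ τ          : ℕ → Exp
  Γ Δ                : Ctx
  t t' u u' v v' A A' B B' C U U' T T' F G : Exp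

-- Renaming and substitution

infixl 5 _∷ˢ_

_∷ˢ_ : (ℕ → Exp) → Exp → ℕ → Exp
(σ ∷ˢ u) zero    = u
(σ ∷ˢ u) (suc n) = σ n

cong-pi : ∀ {U U' T T'} → U ≐ U' → T ≐ T' → pi a i j U T ≐ pi a i j U' T'
cong-pi refl refl = refl

liftRen-cong : (∀ x → ρ x ≐ ρ' x) → ∀ x → liftRen ρ x ≐ liftRen ρ' x
liftRen-cong e zero    = refl
liftRen-cong e (suc x) = cong suc (e x)

rename-cong : (∀ x → ρ x ≐ ρ' x) → ∀ t → rename ρ t ≐ rename ρ' t
rename-cong e (sort k)       = refl
rename-cong e (pi a i j U T) = cong-pi (rename-cong e U) (rename-cong (liftRen-cong e) T)
rename-cong e (var x)        = cong var (e x)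
rename-cong e (lam a U t)    = cong₂ (lam a) (rename-cong e U) (rename-cong (liftRen-cong e) t)
rename-cong e (app a t u)    = cong₂ (app a) (rename-cong e t) (rename-cong e u)

liftSub-cong : (∀ x → σ x ≐ τ x) → ∀ x → liftSub σ x ≐ liftSub τ x
liftSub-cong e zero    = refl
liftSub-cong e (suc x) = cong wk (e x)

subst-cong : (∀ x → σ x ≐ τ x) → ∀ t → subst σ t ≐ subst τ t
subst-cong e (sort k)       = refl
subst-cong e (pi a i j U T) = cong-pi (subst-cong e U) (subst-cong (liftSub-cong e) T)
subst-cong e (var x)        = e x
subst-cong e (lam a U t)    = cong₂ (lam a) (subst-cong e U) (subst-cong (liftSub-cong e) t)
subst-cong e (app a t u)    = cong₂ (app a) (subst-cong e t) (subst-cong e u)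

subst-var : (∀ x → σ x ≐ var (ρ x)) → ∀ t → subst σ t ≐ rename ρ t
subst-var {σ} {ρ} e = go e
  where
  lift : ∀ {σ ρ} → (∀ x → σ x ≐ var (ρ x)) → ∀ x → liftSub σ x ≐ var (liftRen ρ x)
  lift e zero    = refl
  lift e (suc x) = cong wk (e x)
  go : ∀ {σ ρ} → (∀ x → σ x ≐ var (ρ x)) → ∀ t → subst σ t ≐ rename ρ t
  go e (sort k)       = refl
  go e (pi a i j U T) = cong-pi (go e U) (go (lift e) T)
  go e (var x)        = e x
  go e (lam a U t)    = cong₂ (lam a) (go e U) (go (lift e) t)
  go e (app a t u)    = cong₂ (app a) (go e t) (go e u)

rename-id : (∀ x → ρ x ≐ x) → ∀ t → rename ρ t ≐ t
rename-id e (sort k)       = refl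
rename-id e (pi a i j U T) = cong-pi (rename-id e U) (rename-id (λ { zero → refl ; (suc x) → cong suc (e x) }) T)
rename-id e (var x)        = cong var (e x)
rename-id e (lam a U t)    = cong₂ (lam a) (rename-id e U) (rename-id (λ { zero → refl ; (suc x) → cong suc (e x) }) t)
rename-id e (app a t u)    = cong₂ (app a) (rename-id e t) (rename-id e u)

subst-id : (∀ x → σ x ≐ var x) → ∀ t → subst σ t ≐ t
subst-id e t = trans (subst-var e t) (rename-id (λ _ → refl) t)

subst-rename : ∀ σ ρ t → subst σ (rename ρ t) ≐ subst (σ ∘ ρ) t
subst-rename σ ρ t = go (λ _ → refl) t
  where
  lift : ∀ {σ ρ τ} → (∀ x → σ (ρ x) ≐ τ x) → ∀ x → liftSub σ (liftRen ρ x) ≐ liftSub τ x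
  lift e zero    = refl
  lift e (suc x) = cong wk (e x)
  go : ∀ {σ ρ τ} → (∀ x → σ (ρ x) ≐ τ x) → ∀ t → subst σ (rename ρ t) ≐ subst τ t
  go e (sort k)       = refl
  go e (pi a i j U T) = cong-pi (go e U) (go (lift e) T)
  go e (var x)        = e x
  go e (lam a U t)    = cong₂ (lam a) (go e U) (go (lift e) t)
  go e (app a t u)    = cong₂ (app a) (go e t) (go e u)

rename-rename : ∀ ρ' ρ t → rename ρ' (rename ρ t) ≐ rename (ρ' ∘ ρ) t
rename-rename ρ' ρ t =
  trans (sym (subst-var {var ∘ ρ'} (λ _ → refl) (rename ρ t)))
    (trans (subst-rename (var ∘ ρ') ρ t) (subst-var (λ _ → refl) t))

wk-rename : ∀ ρ t → rename (liftRen ρ) (wk t) ≐ wk (rename ρ t)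
wk-rename ρ t = trans (rename-rename _ _ t) (sym (rename-rename _ _ t))

rename-subst : ∀ ρ σ t → rename ρ (subst σ t) ≐ subst (rename ρ ∘ σ) t
rename-subst ρ σ t = go (λ _ → refl) t
  where
  lift : ∀ {ρ σ τ} → (∀ x → rename ρ (σ x) ≐ τ x) → ∀ x → rename (liftRen ρ) (liftSub σ x) ≐ liftSub τ x
  lift e zero    = refl
  lift {ρ} {σ} e (suc x) = trans (wk-rename ρ (σ x)) (cong wk (e x))
  go : ∀ {ρ σ τ} → (∀ x → rename ρ (σ x) ≐ τ x) → ∀ t → rename ρ (subst σ t) ≐ subst τ t
  go e (sort k)       = refl
  go e (pi a i j U T) = cong-pi (go e U) (go (lift e) T)
  go e (var x)        = e x
  go e (lam a U t)    = cong₂ (lam a) (go e U) (go (lift e) t)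
  go e (app a t u)    = cong₂ (app a) (go e t) (go e u)

wk-subst : ∀ σ t → subst (liftSub σ) (wk t) ≐ wk (subst σ t)
wk-subst σ t = trans (subst-rename _ _ t) (sym (rename-subst suc σ t))

subst-subst : ∀ τ σ t → subst τ (subst σ t) ≐ subst (subst τ ∘ σ) t
subst-subst τ σ t = go (λ _ → refl) t
  where
  lift : ∀ {τ σ υ} → (∀ x → subst τ (σ x) ≐ υ x) → ∀ x → subst (liftSub τ) (liftSub σ x) ≐ liftSub υ x
  lift e zero    = refl
  lift {τ} {σ} e (suc x) = trans (wk-subst τ (σ x)) (cong wk (e x))
  go : ∀ {τ σ υ} → (∀ x → subst τ (σ x) ≐ υ x) → ∀ t → subst τ (subst σ t) ≐ subst υ t
  go e (sort k)       = refl
  go e (pi a i j U T) = cong-pi (go e U) (go (lift e) T)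
  go e (var x)        = e x
  go e (lam a U t)    = cong₂ (lam a) (go e U) (go (lift e) t)
  go e (app a t u)    = cong₂ (app a) (go e t) (go e u)

wk-single : ∀ u t → wk t [ u ] ≐ t
wk-single u t = trans (subst-rename _ _ t) (subst-id (λ _ → refl) t)

subst-lift-single : ∀ σ u t → subst (liftSub σ) t [ u ] ≐ subst (σ ∷ˢ u) t
subst-lift-single σ u t = trans (subst-subst _ _ t)
  (subst-cong (λ { zero → refl ; (suc x) → wk-single u (σ x) }) t)

rename-lift-subst-single : ∀ ρ σ u t →
  rename (liftRen ρ) (subst (liftSub σ) t) [ u ] ≐ subst ((rename ρ ∘ σ) ∷ˢ u) t
rename-lift-subst-single ρ σ u t = trans (cong _[ u ] (rename-subst _ _ t))
  (trans (subst-subst _ _ t)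
    (subst-cong (λ { zero → refl ; (suc x) → trans (cong _[ u ] (wk-rename ρ (σ x))) (wk-single u _) }) t))

rename-lift-single : ∀ ρ u t → rename (liftRen ρ) t [ u ] ≐ subst ((var ∘ ρ) ∷ˢ u) t
rename-lift-single ρ u t = trans (subst-rename _ _ t)
  (subst-cong (λ { zero → refl ; (suc x) → refl }) t)

subst-single : ∀ σ u t → subst σ (t [ u ]) ≐ subst (σ ∷ˢ subst σ u) t
subst-single σ u t = trans (subst-subst _ _ t) (subst-cong (λ { zero → refl ; (suc x) → refl }) t)

subst-[] : ∀ σ u t → subst σ (t [ u ]) ≐ subst (liftSub σ) t [ subst σ u ]
subst-[] σ u t = trans (subst-single σ u t) (sym (subst-lift-single σ _ t))

rename-[] : ∀ ρ u t → rename ρ (t [ u ]) ≐ rename (liftRen ρ) t [ rename ρ u ]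
rename-[] ρ u t = trans (rename-subst _ _ t)
  (trans (subst-cong (λ { zero → refl ; (suc x) → refl }) t) (sym (subst-rename _ _ t)))

rename-lift-wk-var0 : ∀ t → rename (liftRen suc) t [ var 0 ] ≐ t
rename-lift-wk-var0 t = trans (rename-lift-single suc (var 0) t)
  (subst-id (λ { zero → refl ; (suc x) → refl }) t)

rename-lift-id-single : ∀ u t → rename (liftRen id) t [ u ] ≐ t [ u ]
rename-lift-id-single u t =
  cong _[ u ] (rename-id (λ { zero → refl ; (suc x) → refl }) t)

rename-lift-lift-single : ∀ ρ' ρ u t →
  rename (liftRen ρ') (rename (liftRen ρ) t) [ u ] ≐ rename (liftRen (ρ' ∘ ρ)) t [ u ]
rename-lift-lift-single ρ' ρ u t = cong _[ u ]
  (trans (rename-rename _ _ t) (rename-cong (λ { zero → refl ; (suc x) → refl }) t))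

rename-idᶠ : ∀ t → rename id t ≐ t
rename-idᶠ = rename-id (λ _ → refl)

-- Typed renamings

⊕-idem : ∀ Γ → Γ ⊕ ⊕ ≐ Γ ⊕
⊕-idem ε             = refl
⊕-idem (Γ ▸ (a , U)) = cong (_▸ (rel , U)) (⊕-idem Γ)

∋-⊕ : ∀ {x} → Γ ∋ x ∶ A → Γ ⊕ ∋ x ∶ A
∋-⊕ here      = here
∋-⊕ (there h) = there (∋-⊕ h)

-- Renamings are also allowed to resurrect variables: the identity is a renaming from Γ to Γ ⊕.
record Ren (Δ : Ctx) (ρ : ℕ → ℕ) (Γ : Ctx) : Set where
  constructor mkRen
  field
    ⊢cod   : ⊢ Δ
    -- Carried as a field because deriving it from `⊢cod` is the lemma `⊢-⊕`, whose proof is itself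
    -- an application of `ren-ty`.
    ⊢cod-⊕ : ⊢ Δ ⊕
    ren-∋  : ∀ {x A} → Γ ∋ x ∶ A → Δ ∋ ρ x ∶ rename ρ A
    ren-∋⊕ : ∀ {x A} → Γ ⊕ ∋ x ∶ A → Δ ⊕ ∋ ρ x ∶ rename ρ A
open Ren

⊢-resp : Γ ≐ Δ → ⊢ Γ → ⊢ Δ
⊢-resp refl w = w

∋-resp : ∀ {x} → Γ ≐ Δ → Γ ∋ x ∶ A → Δ ∋ x ∶ A
∋-resp refl h = h

∋-resp-ty : ∀ {x} → A ≐ B → Γ ∋ x ∶ A → Γ ∋ x ∶ B
∋-resp-ty refl h = h

resurrect : Ren Δ ρ Γ → Ren (Δ ⊕) ρ Γ
resurrect {Δ} r = mkRen (⊢cod-⊕ r) (⊢-resp (sym (⊕-idem Δ)) (⊢cod-⊕ r)) (∋-⊕ ∘ ren-∋ r)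
  (∋-resp (sym (⊕-idem Δ)) ∘ ren-∋⊕ r)

ren-⊕ : Ren Δ ρ Γ → Ren (Δ ⊕) ρ (Γ ⊕)
ren-⊕ {Δ} {Γ = Γ} r = mkRen (⊢cod-⊕ r) (⊢-resp (sym (⊕-idem Δ)) (⊢cod-⊕ r)) (ren-∋⊕ r)
  (∋-resp (sym (⊕-idem Δ)) ∘ ren-∋⊕ r ∘ ∋-resp (⊕-idem Γ))

liftRen-∋ : ∀ {x Γ Δ} → (∀ {x A} → Γ ∋ x ∶ A → Δ ∋ ρ x ∶ rename ρ A) →
  (Γ ▸ (a , U)) ∋ x ∶ A → (Δ ▸ (a , rename ρ U)) ∋ liftRen ρ x ∶ rename (liftRen ρ) A
liftRen-∋ {ρ} f (here {U = U})  = ∋-resp-ty (sym (wk-rename ρ U)) here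
liftRen-∋ {ρ} f (there {U = U} h) = ∋-resp-ty (sym (wk-rename ρ U)) (there (f h))

lift-ren : Ren Δ ρ Γ → Δ ⊢ rename ρ U ∶ sort i → Δ ⊕ ⊢ rename ρ U ∶ sort j →
  Ren (Δ ▸ (a , rename ρ U)) (liftRen ρ) (Γ ▸ (a , U))
lift-ren r d d⊕ = mkRen (ctx-▸ (⊢cod r) d) (ctx-▸ (⊢cod-⊕ r) d⊕) (liftRen-∋ (ren-∋ r)) (liftRen-∋ (ren-∋⊕ r))

ren-∘ : Ren Δ ρ' Γ → ∀ {Θ} → Ren Γ ρ Θ → Ren Δ (ρ' ∘ ρ) Θ
ren-∘ {ρ' = ρ'} {ρ = ρ} r s = mkRen (⊢cod r) (⊢cod-⊕ r)
  (λ {_} {A} h → ∋-resp-ty (rename-rename ρ' ρ A) (ren-∋ r (ren-∋ s h)))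
  (λ {_} {A} h → ∋-resp-ty (rename-rename ρ' ρ A) (ren-∋⊕ r (ren-∋⊕ s h)))

⊢-ty : t ≐ t' → A ≐ B → Γ ⊢ t ∶ A → Γ ⊢ t' ∶ B
⊢-ty refl refl d = d

⊢-eq : t ≐ t' → u ≐ u' → A ≐ B → Γ ⊢ t ≡ u ∶ A → Γ ⊢ t' ≡ u' ∶ B
⊢-eq refl refl refl d = d

-- The sought entry may lie below further ones: at `eq-β` the walk continues in a premise over an
-- extended context, and `ctx-entry` has to skip what was added.
data Prefix (Γ : Ctx) : Ctx → Set where
  whole : Prefix Γ Γ
  drop  : ∀ {Θ e} → Prefix Γ Θ → Prefix Γ (Θ ▸ e)

-- Renaming under a binder needs the renamed domain to be well formed; when the rule has no premise
-- for it, it is found in the context of a premise. The functions *-entry walk to a leaf to get it.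
ren-ty      : Γ ⊢ t ∶ A → Ren Δ ρ Γ → Δ ⊢ rename ρ t ∶ rename ρ A
ren-eq      : Γ ⊢ t ≡ u ∶ A → Ren Δ ρ Γ → Δ ⊢ rename ρ t ≡ rename ρ u ∶ rename ρ A
ren-ann     : Γ ⊢ u ∶[ a ] A → Ren Δ ρ Γ → Δ ⊢ rename ρ u ∶[ a ] rename ρ A
ren-eqann   : Γ ⊢ u ≡ u' ∶[ a ] A → Ren Δ ρ Γ → Δ ⊢ rename ρ u ≡ rename ρ u' ∶[ a ] rename ρ A
ctx-entry   : ∀ {Θ} → ⊢ Θ → Prefix (Γ ▸ (a , U)) Θ → Ren Δ ρ Γ → ∃ λ k → Δ ⊢ rename ρ U ∶ sort k
ty-entry    : ∀ {Θ} → Θ ⊢ t ∶ A → Prefix (Γ ▸ (a , U)) Θ → Ren Δ ρ Γ → ∃ λ k → Δ ⊢ rename ρ U ∶ sort k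
eq-entry    : ∀ {Θ} → Θ ⊢ t ≡ u ∶ A → Prefix (Γ ▸ (a , U)) Θ → Ren Δ ρ Γ → ∃ λ k → Δ ⊢ rename ρ U ∶ sort k
under-ty    : (Γ ▸ (a , U)) ⊢ t ∶ A → Ren Δ ρ Γ → Ren (Δ ▸ (a , rename ρ U)) (liftRen ρ) (Γ ▸ (a , U))
under-eq    : (Γ ▸ (a , U)) ⊢ t ≡ u ∶ A → Ren Δ ρ Γ → Ren (Δ ▸ (a , rename ρ U)) (liftRen ρ) (Γ ▸ (a , U))

-- `d` is a subderivation of the premise at which the walk began, so handing it to `ren-ty` keeps
-- the mutual recursion structural.
ctx-entry (ctx-▸ w d) whole    r = _ , ren-ty d r
ctx-entry (ctx-▸ w d) (drop p) r = ctx-entry w p r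

ty-entry (ty-sort w)   p r = ctx-entry w p r
ty-entry (ty-pi d _)   p r = ty-entry d p r
ty-entry (ty-var w _)  p r = ctx-entry w p r
ty-entry (ty-lam _ d)  p r = ty-entry d p r
ty-entry (ty-app d _)  p r = ty-entry d p r
ty-entry (ty-conv d _) p r = ty-entry d p r

eq-entry (eq-β d _)     p r = ty-entry d (drop p) r
eq-entry (eq-η d)       p r = ty-entry d p r
eq-entry (eq-refl d)    p r = ty-entry d p r
eq-entry (eq-sym d)     p r = eq-entry d p r
eq-entry (eq-trans d _) p r = eq-entry d p r
eq-entry (eq-pi d _)    p r = eq-entry d p r
eq-entry (eq-lam d _ _) p r = eq-entry d p r
eq-entry (eq-app d _)   p r = eq-entry d p r
eq-entry (eq-conv d _)  p r = eq-entry d p r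

under-ty d r = lift-ren r (proj₂ (ty-entry d whole r)) (proj₂ (ty-entry d whole (resurrect r)))
under-eq d r = lift-ren r (proj₂ (eq-entry d whole r)) (proj₂ (eq-entry d whole (resurrect r)))

ren-ty (ty-sort w)   r = ty-sort (⊢cod r)
ren-ty (ty-pi d e)   r = ty-pi (ren-ty d r) (ren-ty e (under-ty e r))
ren-ty (ty-var w h)  r = ty-var (⊢cod r) (ren-∋ r h)
ren-ty (ty-lam d e)  r = ty-lam (ren-ty d (under-ty d r)) (ren-ty e r)
ren-ty {ρ = ρ} (ty-app {T = T} {u = u} d e)  r =
  ⊢-ty refl (sym (rename-[] ρ u T)) (ty-app (ren-ty d r) (ren-ann e r))
ren-ty (ty-conv d e) r = ty-conv (ren-ty d r) (ren-eq e r)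

ren-eq {ρ = ρ} (eq-β {T = T} {t = t} {u = u} d e) r =
  ⊢-eq refl (sym (rename-[] ρ u t)) (sym (rename-[] ρ u T))
    (eq-β (ren-ty d (under-ty d r)) (ren-ann e r))
ren-eq {ρ = ρ} (eq-η {a = a} {U = U} {t = t} d) r =
  ⊢-eq refl (cong (λ x → lam a (rename ρ U) (app a x (var 0))) (sym (wk-rename ρ t))) refl (eq-η (ren-ty d r))
ren-eq (eq-refl d)    r = eq-refl (ren-ty d r)
ren-eq (eq-sym d)     r = eq-sym (ren-eq d r)
ren-eq (eq-trans d e) r = eq-trans (ren-eq d r) (ren-eq e r)
ren-eq (eq-pi d e)    r = eq-pi (ren-eq d r) (ren-eq e (under-eq e r))
ren-eq (eq-lam d e f) r = eq-lam (ren-eq d r) (ren-ty e (under-ty e r)) (ren-eq f (under-eq f r))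
ren-eq {ρ = ρ} (eq-app {T = T} {u = u} d e)   r =
  ⊢-eq refl refl (sym (rename-[] ρ u T)) (eq-app (ren-eq d r) (ren-eqann e r))
ren-eq (eq-conv d e)  r = eq-conv (ren-eq d r) (ren-eq e r)

ren-ann (ann-rel d) r = ann-rel (ren-ty d r)
ren-ann (ann-irr d) r = ann-irr (ren-ty d (ren-⊕ r))

ren-eqann (eqann-rel d)   r = eqann-rel (ren-eq d r)
ren-eqann (eqann-irr d e) r = eqann-irr (ren-ty d (ren-⊕ r)) (ren-ty e (ren-⊕ r))

ty-wf : Γ ⊢ t ∶ A → ⊢ Γ
ty-wf (ty-sort w)   = w
ty-wf (ty-pi d _)   = ty-wf d
ty-wf (ty-var w _)  = w
ty-wf (ty-lam _ d)  = ty-wf d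
ty-wf (ty-app d _)  = ty-wf d
ty-wf (ty-conv d _) = ty-wf d

resurrect-id : ⊢ Γ ⊕ → Ren (Γ ⊕) id Γ
resurrect-id {Γ} w = mkRen w (⊢-resp (sym (⊕-idem Γ)) w)
  (λ {_} {A} h → ∋-resp-ty (sym (rename-idᶠ A)) (∋-⊕ h))
  (λ {_} {A} h → ∋-resp-ty (sym (rename-idᶠ A)) (∋-resp (sym (⊕-idem Γ)) h))

-- Each entry is retyped by renaming along the identity, which counts as a renaming into the
-- resurrected context.
⊢-⊕ : ⊢ Γ → ⊢ Γ ⊕
⊢-⊕ ctx-ε       = ctx-ε
⊢-⊕ (ctx-▸ {T = T} w d) = ctx-▸ (⊢-⊕ w) (⊢-ty (rename-idᶠ T) refl (ren-ty d (resurrect-id (⊢-⊕ w))))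

id-ren : ⊢ Γ → Ren Γ id Γ
id-ren w = mkRen w (⊢-⊕ w)
  (λ {_} {A} h → ∋-resp-ty (sym (rename-idᶠ A)) h) (λ {_} {A} h → ∋-resp-ty (sym (rename-idᶠ A)) h)

wk-ren : ⊢ (Γ ▸ (a , U)) → Ren (Γ ▸ (a , U)) suc Γ
wk-ren w = mkRen w (⊢-⊕ w) there there

-- Presuppositions are only available after the fundamental theorem; until then they are carried along.
record _⊢_≣_∶_ (Γ : Ctx) (t u A : Exp) : Set where
  constructor ⟪_,_,_⟫
  field
    lhs : Γ ⊢ t ∶ A
    rhs : Γ ⊢ u ∶ A
    equ : Γ ⊢ t ≡ u ∶ A
open _⊢_≣_∶_

infix 4 _⊢_≣_∶_

≣-refl : Γ ⊢ t ∶ A → Γ ⊢ t ≣ t ∶ A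
≣-refl d = ⟪ d , d , eq-refl d ⟫

≣-sym : Γ ⊢ t ≣ u ∶ A → Γ ⊢ u ≣ t ∶ A
≣-sym ⟪ d , e , f ⟫ = ⟪ e , d , eq-sym f ⟫

≣-trans : Γ ⊢ t ≣ u ∶ A → Γ ⊢ u ≣ v ∶ A → Γ ⊢ t ≣ v ∶ A
≣-trans ⟪ d , _ , f ⟫ ⟪ _ , e , g ⟫ = ⟪ d , e , eq-trans f g ⟫

≣-conv : Γ ⊢ t ≣ u ∶ A → Γ ⊢ A ≣ B ∶ sort k → Γ ⊢ t ≣ u ∶ B
≣-conv ⟪ d , e , f ⟫ ⟪ _ , _ , g ⟫ = ⟪ ty-conv d g , ty-conv e g , eq-conv f g ⟫

≣-conv⁻ : Γ ⊢ t ≣ u ∶ B → Γ ⊢ A ≣ B ∶ sort k → Γ ⊢ t ≣ u ∶ A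
≣-conv⁻ e f = ≣-conv e (≣-sym f)

≣-ren : Γ ⊢ t ≣ u ∶ A → Ren Δ ρ Γ → Δ ⊢ rename ρ t ≣ rename ρ u ∶ rename ρ A
≣-ren ⟪ d , e , f ⟫ r = ⟪ ren-ty d r , ren-ty e r , ren-eq f r ⟫

-- Weak head reduction

data _⟶_ : Exp → Exp → Set where
  β    : app a (lam a U t) u ⟶ (t [ u ])
  appˡ : t ⟶ t' → app a t u ⟶ app a t' u

data _⟶*_ : Exp → Exp → Set where
  done : t ⟶* t
  _◅_  : t ⟶ u → u ⟶* v → t ⟶* v

infix  4 _⟶_ _⟶*_
infixr 5 _◅_ _◅◅_

_◅◅_ : t ⟶* u → u ⟶* v → t ⟶* v
done    ◅◅ s = s
(x ◅ r) ◅◅ s = x ◅ (r ◅◅ s)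

data Ne : Exp → Set where
  var : ∀ {x} → Ne (var x)
  app : Ne t → Ne (app a t u)

data Whnf : Exp → Set where
  sort : Whnf (sort k)
  pi   : Whnf (pi a i j U T)
  lam  : Whnf (lam a U t)
  ne   : Ne t → Whnf t

ne-stuck : Ne t → ¬ (t ⟶ u)
ne-stuck (app ()) β
ne-stuck (app n) (appˡ s) = ne-stuck n s

whnf-stuck : Whnf t → ¬ (t ⟶ u)
whnf-stuck sort   ()
whnf-stuck pi     ()
whnf-stuck lam    ()
whnf-stuck (ne n) s = ne-stuck n s

⟶-det : t ⟶ u → t ⟶ v → u ≐ v
⟶-det β        β         = refl
⟶-det β        (appˡ ())
⟶-det (appˡ ()) β
⟶-det (appˡ s) (appˡ s') = cong (λ x → app _ x _) (⟶-det s s')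

⟶*-det : t ⟶* u → t ⟶* v → Whnf u → Whnf v → u ≐ v
⟶*-det done     done       wu wv = refl
⟶*-det done     (s ◅ _)    wu wv = ⊥-elim (whnf-stuck wu s)
⟶*-det (s ◅ _)  done       wu wv = ⊥-elim (whnf-stuck wv s)
⟶*-det (s ◅ r)  (s' ◅ r')  wu wv with refl ← ⟶-det s s' = ⟶*-det r r' wu wv

⟶*-whnf : t ⟶* u → t ⟶* v → Whnf v → u ⟶* v
⟶*-whnf done    r'       w = r'
⟶*-whnf (s ◅ _) done     w = ⊥-elim (whnf-stuck w s)
⟶*-whnf (s ◅ r) (s' ◅ r') w with refl ← ⟶-det s s' = ⟶*-whnf r r' w

appˡ* : t ⟶* t' → app a t u ⟶* app a t' u
appˡ* done    = done
appˡ* (s ◅ r) = appˡ s ◅ appˡ* r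

⟶-resp : u ≐ v → t ⟶ u → t ⟶ v
⟶-resp refl s = s

⟶-ren : ∀ ρ → t ⟶ u → rename ρ t ⟶ rename ρ u
⟶-ren ρ (β {t = t} {u = u}) = ⟶-resp (sym (rename-[] ρ u t)) β
⟶-ren ρ (appˡ s)            = appˡ (⟶-ren ρ s)

⟶*-ren : ∀ ρ → t ⟶* u → rename ρ t ⟶* rename ρ u
⟶*-ren ρ done    = done
⟶*-ren ρ (s ◅ r) = ⟶-ren ρ s ◅ ⟶*-ren ρ r

ne-ren : ∀ ρ → Ne t → Ne (rename ρ t)
ne-ren ρ var     = var
ne-ren ρ (app n) = app (ne-ren ρ n)

-- Free variables

liftPred : (ℕ → Bool) → ℕ → Bool
liftPred P zero    = false
liftPred P (suc x) = P x

-- A predicate instead of a single variable, because the tracked variable shifts under binders.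
occurs : (ℕ → Bool) → Exp → Bool
occurs P (sort k)       = false
occurs P (pi a i j U T) = occurs P U ∨ occurs (liftPred P) T
occurs P (var x)        = P x
occurs P (lam a U t)    = occurs P U ∨ occurs (liftPred P) t
occurs P (app a t u)    = occurs P t ∨ occurs P u

occurs-rename : ∀ {P Q} → (∀ x → P (ρ x) ≐ Q x) → ∀ t → occurs P (rename ρ t) ≐ occurs Q t
occurs-rename {ρ} {P} {Q} e = λ where
    (sort k)       → refl
    (pi a i j U T) → cong₂ _∨_ (occurs-rename e U) (occurs-rename lift T)
    (var x)        → e x
    (lam a U t)    → cong₂ _∨_ (occurs-rename e U) (occurs-rename lift t)
    (app a t u)    → cong₂ _∨_ (occurs-rename e t) (occurs-rename e u)
  where
  lift : ∀ x → liftPred P (liftRen ρ x) ≐ liftPred Q x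
  lift zero    = refl
  lift (suc x) = e x

occurs-none : ∀ {P} → (∀ x → P x ≐ false) → ∀ t → occurs P t ≐ false
occurs-none e (sort k) = refl
occurs-none e (pi a i j U T)
  rewrite occurs-none e U | occurs-none {liftPred _} (λ { zero → refl ; (suc x) → e x }) T = refl
occurs-none e (var x)  = e x
occurs-none e (lam a U t)
  rewrite occurs-none e U | occurs-none {liftPred _} (λ { zero → refl ; (suc x) → e x }) t = refl
occurs-none e (app a t u) rewrite occurs-none e t | occurs-none e u = refl

rename-agree : ∀ {P} → (∀ x → P x ≐ false → ρ x ≐ ρ' x) → ∀ t → occurs P t ≐ false → rename ρ t ≐ rename ρ' t
rename-agree {ρ} {ρ'} {P} e = λ where
    (sort k)       _ → refl
    (pi a i j U T) o → cong-pi (rename-agree e U (∨-conicalˡ _ _ o))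
                               (rename-agree lift T (∨-conicalʳ (occurs P U) _ o))
    (var x)        o → cong var (e x o)
    (lam a U t)    o → cong₂ (lam a) (rename-agree e U (∨-conicalˡ _ _ o))
                                     (rename-agree lift t (∨-conicalʳ (occurs P U) _ o))
    (app a t u)    o → cong₂ (app a) (rename-agree e t (∨-conicalˡ _ _ o))
                                     (rename-agree e u (∨-conicalʳ (occurs P t) _ o))
  where
  lift : ∀ x → liftPred P x ≐ false → liftRen ρ x ≐ liftRen ρ' x
  lift zero    _ = refl
  lift (suc x) o = cong suc (e x o)

isZero : ℕ → Bool
isZero zero    = true
isZero (suc _) = false

occurs-wk : ∀ t → occurs isZero (wk t) ≐ false
occurs-wk t = trans (occurs-rename {P = isZero} (λ _ → refl) t) (occurs-none (λ _ → refl) t)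

-- `suc ∘ pred` is the identity away from 0, so `rename pred` serves as strengthening.
wk-pred : ∀ t → occurs isZero t ≐ false → wk (rename pred t) ≐ t
wk-pred t o = trans (rename-rename _ _ t)
  (trans (rename-agree (λ { zero () ; (suc x) _ → refl }) t o) (rename-idᶠ t))

pred-wk : ∀ t → rename pred (wk t) ≐ t
pred-wk t = trans (rename-rename _ _ t) (rename-idᶠ t)

wk-injective : wk t ≐ wk u → t ≐ u
wk-injective {t} {u} e = trans (sym (pred-wk t)) (trans (cong (rename pred) e) (pred-wk u))

-- Decidable syntactic equality

_≟ᵃ_ : (a b : Ann) → Dec (a ≐ b)
rel ≟ᵃ rel = yes refl
rel ≟ᵃ irr = no λ ()
irr ≟ᵃ rel = no λ ()
irr ≟ᵃ irr = yes refl

_≟_ : (t u : Exp) → Dec (t ≐ u)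
sort k ≟ sort l with k ℕₚ.≟ l
... | yes refl = yes refl
... | no ¬p    = no λ { refl → ¬p refl }
pi a i j U T ≟ pi a' i' j' U' T' with a ≟ᵃ a' | i ℕₚ.≟ i' | j ℕₚ.≟ j' | U ≟ U' | T ≟ T'
... | yes refl | yes refl | yes refl | yes refl | yes refl = yes refl
... | no ¬p | _ | _ | _ | _ = no λ { refl → ¬p refl }
... | _ | no ¬p | _ | _ | _ = no λ { refl → ¬p refl }
... | _ | _ | no ¬p | _ | _ = no λ { refl → ¬p refl }
... | _ | _ | _ | no ¬p | _ = no λ { refl → ¬p refl }
... | _ | _ | _ | _ | no ¬p = no λ { refl → ¬p refl }
var x ≟ var y with x ℕₚ.≟ y
... | yes refl = yes refl
... | no ¬p    = no λ { refl → ¬p refl }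
lam a U t ≟ lam a' U' t' with a ≟ᵃ a' | U ≟ U' | t ≟ t'
... | yes refl | yes refl | yes refl = yes refl
... | no ¬p | _ | _ = no λ { refl → ¬p refl }
... | _ | no ¬p | _ = no λ { refl → ¬p refl }
... | _ | _ | no ¬p = no λ { refl → ¬p refl }
app a t u ≟ app a' t' u' with a ≟ᵃ a' | t ≟ t' | u ≟ u'
... | yes refl | yes refl | yes refl = yes refl
... | no ¬p | _ | _ = no λ { refl → ¬p refl }
... | _ | no ¬p | _ = no λ { refl → ¬p refl }
... | _ | _ | no ¬p = no λ { refl → ¬p refl }
sort _ ≟ pi _ _ _ _ _ = no λ ()
sort _ ≟ var _ = no λ ()
sort _ ≟ lam _ _ _ = no λ ()
sort _ ≟ app _ _ _ = no λ ()
pi _ _ _ _ _ ≟ sort _ = no λ ()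
pi _ _ _ _ _ ≟ var _ = no λ ()
pi _ _ _ _ _ ≟ lam _ _ _ = no λ ()
pi _ _ _ _ _ ≟ app _ _ _ = no λ ()
var _ ≟ sort _ = no λ ()
var _ ≟ pi _ _ _ _ _ = no λ ()
var _ ≟ lam _ _ _ = no λ ()
var _ ≟ app _ _ _ = no λ ()
lam _ _ _ ≟ sort _ = no λ ()
lam _ _ _ ≟ pi _ _ _ _ _ = no λ ()
lam _ _ _ ≟ var _ = no λ ()
lam _ _ _ ≟ app _ _ _ = no λ ()
app _ _ _ ≟ sort _ = no λ ()
app _ _ _ ≟ pi _ _ _ _ _ = no λ ()
app _ _ _ ≟ var _ = no λ ()
app _ _ _ ≟ lam _ _ _ = no λ ()

-- Normal forms

variable
  m n e e' f g : Exp
  s s'         : ℕ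

-- Normal forms are erased: irrelevant arguments and domains of abstractions become sort 0.
η-arg : Ann → Exp
η-arg rel = var 0
η-arg irr = sort 0

-- ηView a n m: m is the η-contracted form of the erased abstraction with body n.
data ηView (a : Ann) : Exp → Exp → Set where
  contract : ηView a (app a (wk e) (η-arg a)) e
  keep     : (∀ e → ¬ n ≐ app a (wk e) (η-arg a)) → ηView a n (lam a (sort 0) n)

app-inj : app a t u ≐ app a' t' u' → a ≐ a' × t ≐ t' × u ≐ u'
app-inj refl = refl , refl , refl

η-view : ∀ a n → ∃ (ηView a n)
η-view a n@(sort _)       = _ , keep λ _ ()
η-view a n@(pi _ _ _ _ _) = _ , keep λ _ ()
η-view a n@(var _)        = _ , keep λ _ ()
η-view a n@(lam _ _ _)    = _ , keep λ _ ()
η-view a n@(app b e x) with b ≟ᵃ a | x ≟ η-arg a | occurs isZero e in eq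
... | no b≢a   | _        | _     = _ , keep λ { e' refl → b≢a refl }
... | yes refl | no x≢    | _     = _ , keep λ { e' refl → x≢ refl }
... | yes refl | yes refl | true  = _ , keep λ e' p →
  case-bool (trans (sym eq) (trans (cong (occurs isZero) (proj₁ (proj₂ (app-inj p)))) (occurs-wk e')))
  where
  case-bool : ¬ true ≐ false
  case-bool ()
... | yes refl | yes refl | false =
  rename pred e , transport (λ y → ηView a (app a y (η-arg a)) (rename pred e)) (wk-pred e eq) contract

ηView-det : ∀ {m'} → n ≐ e → ηView a n m → ηView a e m' → m ≐ m'
ηView-det p    contract  contract  = wk-injective (proj₁ (proj₂ (app-inj p)))
ηView-det p    contract  (keep ¬c) = ⊥-elim (¬c _ (sym p))
ηView-det p    (keep ¬c) contract  = ⊥-elim (¬c _ p)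
ηView-det refl (keep _)  (keep _)  = refl

-- The point is that renaming creates no η-redex: `liftRen ρ` sends only 0 to 0, even when `ρ` is
-- not injective, so a head that is free of variable 0 after renaming was free of it before.
ηView-ren : ∀ ρ → ηView a n m → ηView a (rename (liftRen ρ) n) (rename ρ m)
ηView-ren {rel} ρ (contract {e}) rewrite wk-rename ρ e = contract
ηView-ren {irr} ρ (contract {e}) rewrite wk-rename ρ e = contract
ηView-ren {a} ρ (keep {n} ¬c) = keep (back n ¬c)
  where
  η-arg-back : ∀ a x → rename (liftRen ρ) x ≐ η-arg a → x ≐ η-arg a
  η-arg-back rel (var zero) p = refl
  η-arg-back irr (sort zero) p = refl
  back : ∀ n → (∀ e → ¬ n ≐ app a (wk e) (η-arg a)) → ∀ e → ¬ rename (liftRen ρ) n ≐ app a (wk e) (η-arg a)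
  back (app b h x) ¬c e p with app-inj p
  ... | refl , q , r = ¬c (rename pred h) (cong₂ (app b) (sym (wk-pred h free)) (η-arg-back b x r))
    where
    free : occurs isZero h ≐ false
    free = trans (sym (occurs-rename {ρ = liftRen ρ} {P = isZero} (λ { zero → refl ; (suc _) → refl }) h))
      (trans (cong (occurs isZero) q) (occurs-wk e))

-- The first index is the weight of the derivation. An abstraction weighs three, so that the weight decreases
-- when an abstraction is compared with a neutral term k via its body and k applied to a fresh variable.
data Nf  : ℕ → Exp → Exp → Set
data Nfⁿ : ℕ → Exp → Exp → Set

data Nf where
  nf-lam  : t ⟶* lam a U u → Nf s u n → ηView a n m → Nf (3 + s) t m
  nf-sort : t ⟶* sort k → Nf 0 t (sort k)
  nf-pi   : t ⟶* pi a i j F G → Nf s F f → Nf s' G g → Nf (suc (s + s')) t (pi a i j f g)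
  nf-ne   : t ⟶* u → Nfⁿ s u e → Nf (suc s) t e

data Nfⁿ where
  nf-var  : ∀ {x} → Nfⁿ 0 (var x) (var x)
  nf-app  : Nfⁿ s t e → Nf s' u n → Nfⁿ (suc (s + s')) (app rel t u) (app rel e n)
  nf-appⁱ : Nfⁿ s t e → Nfⁿ (suc s) (app irr t u) (app irr e (sort 0))

_⇓_ _⇓ⁿ_ : Exp → Exp → Set
t ⇓ n  = ∃ λ s → Nf s t n
t ⇓ⁿ n = ∃ λ s → Nfⁿ s t n

infix 4 _⇓_ _⇓ⁿ_

nfⁿ-ne : Nfⁿ s t e → Ne t
nfⁿ-ne nf-var       = var
nfⁿ-ne (nf-app d _) = app (nfⁿ-ne d)
nfⁿ-ne (nf-appⁱ d)  = app (nfⁿ-ne d)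

nf-exp : t ⟶* u → Nf s u n → Nf s t n
nf-exp r (nf-lam r' d v) = nf-lam (r ◅◅ r') d v
nf-exp r (nf-sort r')    = nf-sort (r ◅◅ r')
nf-exp r (nf-pi r' d d') = nf-pi (r ◅◅ r') d d'
nf-exp r (nf-ne r' d)    = nf-ne (r ◅◅ r') d

nf-det  : ∀ {n'} → Nf s t n → Nf s' t n' → n ≐ n'
nfⁿ-det : Nfⁿ s t e → Nfⁿ s' t e' → e ≐ e'

nf-det (nf-lam r d v) (nf-lam r' d' v') with refl ← ⟶*-det r r' lam lam = ηView-det (nf-det d d') v v'
nf-det (nf-lam r _ _) (nf-sort r')   with () ← ⟶*-det r r' lam sort
nf-det (nf-lam r _ _) (nf-pi r' _ _) with () ← ⟶*-det r r' lam pi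
nf-det (nf-lam r _ _) (nf-ne r' d')  with refl ← ⟶*-det r r' lam (ne (nfⁿ-ne d')) with () ← d'
nf-det (nf-sort r) (nf-lam r' _ _) with () ← ⟶*-det r r' sort lam
nf-det (nf-sort r) (nf-sort r')    with refl ← ⟶*-det r r' sort sort = refl
nf-det (nf-sort r) (nf-pi r' _ _)  with () ← ⟶*-det r r' sort pi
nf-det (nf-sort r) (nf-ne r' d')   with refl ← ⟶*-det r r' sort (ne (nfⁿ-ne d')) with () ← d'
nf-det (nf-pi r _ _) (nf-lam r' _ _)   with () ← ⟶*-det r r' pi lam
nf-det (nf-pi r _ _) (nf-sort r')      with () ← ⟶*-det r r' pi sort
nf-det (nf-pi r d e) (nf-pi r' d' e')  with refl ← ⟶*-det r r' pi pi = cong-pi (nf-det d d') (nf-det e e')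
nf-det (nf-pi r _ _) (nf-ne r' d')     with refl ← ⟶*-det r r' pi (ne (nfⁿ-ne d')) with () ← d'
nf-det (nf-ne r d) (nf-lam r' _ _) with refl ← ⟶*-det r' r lam (ne (nfⁿ-ne d)) with () ← d
nf-det (nf-ne r d) (nf-sort r')    with refl ← ⟶*-det r' r sort (ne (nfⁿ-ne d)) with () ← d
nf-det (nf-ne r d) (nf-pi r' _ _)  with refl ← ⟶*-det r' r pi (ne (nfⁿ-ne d)) with () ← d
nf-det (nf-ne r d) (nf-ne r' d')   with refl ← ⟶*-det r r' (ne (nfⁿ-ne d)) (ne (nfⁿ-ne d')) = nfⁿ-det d d'

nfⁿ-det nf-var       nf-var         = refl
nfⁿ-det (nf-app d e) (nf-app d' e') = cong₂ (app rel) (nfⁿ-det d d') (nf-det e e')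
nfⁿ-det (nf-appⁱ d)  (nf-appⁱ d')   = cong (λ x → app irr x _) (nfⁿ-det d d')

nf-ren  : ∀ ρ → Nf s t n → Nf s (rename ρ t) (rename ρ n)
nfⁿ-ren : ∀ ρ → Nfⁿ s t n → Nfⁿ s (rename ρ t) (rename ρ n)

nf-ren ρ (nf-lam r d v)  = nf-lam (⟶*-ren ρ r) (nf-ren (liftRen ρ) d) (ηView-ren ρ v)
nf-ren ρ (nf-sort r)     = nf-sort (⟶*-ren ρ r)
nf-ren ρ (nf-pi r d d')  = nf-pi (⟶*-ren ρ r) (nf-ren ρ d) (nf-ren (liftRen ρ) d')
nf-ren ρ (nf-ne r d)     = nf-ne (⟶*-ren ρ r) (nfⁿ-ren ρ d)

nfⁿ-ren ρ nf-var       = nf-var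
nfⁿ-ren ρ (nf-app d e) = nf-app (nfⁿ-ren ρ d) (nf-ren ρ e)
nfⁿ-ren ρ (nf-appⁱ d)  = nf-appⁱ (nfⁿ-ren ρ d)

-- The possible weak head normal forms of a function. The index makes the annotation of an
-- abstraction match that of its applications, so that these are β-redexes.
data Fun (a : Ann) : Exp → Set where
  lam : Fun a (lam a U t)
  ne  : t ⇓ⁿ e → Fun a t

fun-ren : ∀ ρ → Fun a t → Fun a (rename ρ t)
fun-ren ρ lam          = lam
fun-ren ρ (ne (_ , d)) = ne (_ , nfⁿ-ren ρ d)

η-size : Ann → ℕ → ℕ
η-size rel s = suc (s + 1)
η-size irr s = suc s

nf-η-arg : Nfⁿ s t e → Nfⁿ (η-size a s) (app a (wk t) (var 0)) (app a (wk e) (η-arg a))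
nf-η-arg {a = rel} d = nf-app (nfⁿ-ren suc d) (nf-ne done nf-var)
nf-η-arg {a = irr} d = nf-appⁱ (nfⁿ-ren suc d)

nf-red : t ⟶* u → Nf s t n → Nf s u n
nf-red r (nf-lam r' d v) = nf-lam (⟶*-whnf r r' lam) d v
nf-red r (nf-sort r')    = nf-sort (⟶*-whnf r r' sort)
nf-red r (nf-pi r' d d') = nf-pi (⟶*-whnf r r' pi) d d'
nf-red r (nf-ne r' d)    = nf-ne (⟶*-whnf r r' (ne (nfⁿ-ne d))) d

-- Applied to a fresh variable, an abstraction β-reduces to its own body, and a neutral term yields
-- an η-redex whose contraction is the normal form it had already.
nf-fun : t ⟶* u → Fun a u → app a (wk t) (var 0) ⇓ n → ηView a n m → t ⇓ m
nf-fun r (lam {t = b}) (_ , d) v = _ , nf-lam r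
  (transport (λ x → Nf _ x _) (rename-lift-wk-var0 b) (nf-red (appˡ* (⟶*-ren suc r) ◅◅ (β ◅ done)) d)) v
nf-fun r (ne (_ , d)) (_ , d') v
  with refl ← nf-det d' (nf-exp (appˡ* (⟶*-ren suc r)) (nf-ne done (nf-η-arg d)))
  = _ , nf-ne r (transport (Nfⁿ _ _) (ηView-det refl contract v) d)

-- The logical relation

variable
  N M     : ℕ
  F' G' K : Exp

-- Reduction is untyped; the judgemental equality is stored beside it because subject reduction is a
-- consequence of the fundamental theorem.
record _⊢_↘_∶_ (Γ : Ctx) (t u A : Exp) : Set where
  constructor _,_
  field
    red : t ⟶* u
    typ : Γ ⊢ t ≣ u ∶ A
open _⊢_↘_∶_

record _⊢_~_∶_ (Γ : Ctx) (t u A : Exp) : Set where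
  constructor neEq
  field
    typ   : Γ ⊢ t ≣ u ∶ A
    {nrm} : Exp
    nfˡ   : t ⇓ⁿ nrm
    nfʳ   : u ⇓ⁿ nrm
open _⊢_~_∶_

infix 4 _⊢_↘_∶_ _⊢_~_∶_

↘-refl : Γ ⊢ t ∶ A → Γ ⊢ t ↘ t ∶ A
↘-refl d = done , ≣-refl d

↘-trans : Γ ⊢ t ↘ u ∶ A → Γ ⊢ u ↘ v ∶ A → Γ ⊢ t ↘ v ∶ A
↘-trans (r , e) (r' , e') = r ◅◅ r' , ≣-trans e e'

↘-conv : Γ ⊢ A ≣ B ∶ sort k → Γ ⊢ t ↘ u ∶ A → Γ ⊢ t ↘ u ∶ B
↘-conv e (r , d) = r , ≣-conv d e

↘-ren : Ren Δ ρ Γ → Γ ⊢ t ↘ u ∶ A → Δ ⊢ rename ρ t ↘ rename ρ u ∶ rename ρ A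
↘-ren {ρ = ρ} r (s , d) = ⟶*-ren ρ s , ≣-ren d r

~-conv : Γ ⊢ A ≣ B ∶ sort k → Γ ⊢ t ~ u ∶ A → Γ ⊢ t ~ u ∶ B
~-conv e (neEq d n n') = neEq (≣-conv d e) n n'

~-sym : Γ ⊢ t ~ u ∶ A → Γ ⊢ u ~ t ∶ A
~-sym (neEq d n n') = neEq (≣-sym d) n' n

~-trans : Γ ⊢ t ~ u ∶ A → Γ ⊢ u ~ v ∶ A → Γ ⊢ t ~ v ∶ A
~-trans (neEq d n (_ , n')) (neEq e (_ , m) m') with refl ← nfⁿ-det n' m = neEq (≣-trans d e) n m'

~-ren : Ren Δ ρ Γ → Γ ⊢ t ~ u ∶ A → Δ ⊢ rename ρ t ~ rename ρ u ∶ rename ρ A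
~-ren {ρ = ρ} r (neEq d (_ , n) (_ , n')) = neEq (≣-ren d r) (_ , nfⁿ-ren ρ n) (_ , nfⁿ-ren ρ n')

~-neˡ : Γ ⊢ t ~ u ∶ A → Whnf t
~-neˡ (neEq _ (_ , d) _) = ne (nfⁿ-ne d)

~-neʳ : Γ ⊢ t ~ u ∶ A → Whnf u
~-neʳ (neEq _ _ (_ , d)) = ne (nfⁿ-ne d)

-- The strict order in a form whose proofs descend from the upper bound, so that `kits` can recurse
-- and a `step` leaves the kit unchanged by definition.
data _≺_ (j : ℕ) : ℕ → Set where
  base : j ≺ suc j
  step : j ≺ N → j ≺ suc N

≺-acc : ∀ N → Acc _≺_ N
≺-acc zero    = acc λ ()
≺-acc (suc N) = acc λ { base → ≺-acc N ; (step p) → go (≺-acc N) p }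
  where
  go : ∀ {j} → Acc _≺_ N → j ≺ N → Acc _≺_ j
  go (acc rs) p = rs p

<⇒≺ : k < N → k ≺ N
<⇒≺ {k} {suc N} (s≤s k≤N) with ℕₚ.m≤n⇒m<n∨m≡n k≤N
... | inj₁ k<N  = step (<⇒≺ k<N)
... | inj₂ refl = base

-- The interpretation of one universe: its reducible types and their equality.
record Kit : Set₁ where
  field
    Type   : Ctx → Exp → Set
    TypeEq : ∀ {Γ A} → Type Γ A → Exp → Set

Univ : Kit → Ctx → Exp → Exp → Set
Univ 𝒰 Γ t u = Σ (Kit.Type 𝒰 Γ t) λ p → Kit.Type 𝒰 Γ u × Kit.TypeEq 𝒰 p u

-- Reducible types whose universes all lie below N; the last index is the sort of the type.
module _ {N : ℕ} {kit : ∀ j → j ≺ N → Kit} where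

  data Ty (Γ : Ctx) : Exp → ℕ → Set
  TyEq : Ty Γ A k → Exp → Set
  El   : Ty Γ A k → Exp → Exp → Set
  Arg  : ∀ a F → (∀ {Δ ρ} → Ren Δ ρ Γ → Ty Δ (rename ρ F) i) → ∀ {Δ ρ} → Ren Δ ρ Γ → Exp → Exp → Set

  data Ty Γ where
    ⊩ne   : Γ ⊢ A ↘ K ∶ sort k → Γ ⊢ K ~ K ∶ sort k → Ty Γ A k
    ⊩sort : Γ ⊢ A ↘ sort j ∶ sort (suc j) → j ≺ N → Ty Γ A (suc j)
    ⊩pi   : Γ ⊢ A ↘ pi a i j F G ∶ sort (i ⊔ j) →
            (pF : ∀ {Δ ρ} → Ren Δ ρ Γ → Ty Δ (rename ρ F) i) →
            (pG : ∀ {Δ ρ v} (r : Ren Δ ρ Γ) → Arg a F pF r v v → Ty Δ (rename (liftRen ρ) G [ v ]) j) →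
            -- For `a = irr` the arguments `v` and `v'` are not compared, so this makes the codomain
            -- constant, up to `TyEq`, in an irrelevant argument. That is why `app irr t u` and
            -- `app irr t' u'` can share the type `T [ u ]`.
            (∀ {Δ ρ v v'} (r : Ren Δ ρ Γ) (α : Arg a F pF r v v) → Arg a F pF r v v' →
              TyEq (pG r α) (rename (liftRen ρ) G [ v' ])) →
            Ty Γ A (i ⊔ j)

  TyEq {Γ} {A} {k} (⊩ne {K = K} _ _) B = ∃ λ K' → (Γ ⊢ B ↘ K' ∶ sort k) × (Γ ⊢ K ~ K' ∶ sort k)
  TyEq {Γ} (⊩sort {j = j} _ _) B = Γ ⊢ B ↘ sort j ∶ sort (suc j)
  TyEq {Γ} (⊩pi {a = a} {i} {j} {F} {G} _ pF pG _) B = ∃ λ F' → ∃ λ G' →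
    (Γ ⊢ B ↘ pi a i j F' G' ∶ sort (i ⊔ j)) ×
    (Γ ⊢ pi a i j F G ≣ pi a i j F' G' ∶ sort (i ⊔ j)) ×
    (∀ {Δ ρ} (r : Ren Δ ρ Γ) → TyEq (pF r) (rename ρ F')) ×
    (∀ {Δ ρ v} (r : Ren Δ ρ Γ) (α : Arg a F pF r v v) → TyEq (pG r α) (rename (liftRen ρ) G' [ v ]))

  El {Γ} {A} (⊩ne _ _) t u =
    ∃ λ k → ∃ λ k' → (Γ ⊢ t ↘ k ∶ A) × (Γ ⊢ u ↘ k' ∶ A) × (Γ ⊢ k ~ k' ∶ A)
  El {Γ} (⊩sort {j = j} _ p) t u = (Γ ⊢ t ≣ u ∶ sort j) × Univ (kit j p) Γ t u
  El {Γ} {A} (⊩pi {a = a} {F = F} _ pF pG _) t u = ∃ λ f → ∃ λ g →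
    (Γ ⊢ t ↘ f ∶ A) × (Γ ⊢ u ↘ g ∶ A) × Fun a f × Fun a g × (Γ ⊢ t ≣ u ∶ A) ×
    (∀ {Δ ρ v v'} (r : Ren Δ ρ Γ) (α : Arg a F pF r v v) → Arg a F pF r v v' →
      El (pG r α) (app a (rename ρ t) v) (app a (rename ρ u) v'))

  -- Two irrelevant arguments need not be equal, they only have to exist after resurrection.
  Arg rel F pF r v v' = El (pF r) v v × El (pF r) v' v' × El (pF r) v v'
  Arg irr F pF r v v' = El (pF (resurrect r)) v v × El (pF (resurrect r)) v' v'

kits : ∀ N j → j ≺ N → Kit
kits (suc N) j base     = record { Type = λ Γ A → Ty {j} {kits j} Γ A j ; TypeEq = TyEq }
kits (suc N) j (step p) = kits N j p

_⊩⟨_⟩_∶_ : Ctx → ℕ → Exp → ℕ → Set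
Γ ⊩⟨ N ⟩ A ∶ k = Ty {N} {kits N} Γ A k

infix 4 _⊩⟨_⟩_∶_

universe : ℕ → Kit
universe j = kits (suc j) j base

kits-universe : (p : j ≺ N) → kits N j p ≐ universe j
kits-universe base     = refl
kits-universe (step p) = kits-universe p

fromKit : (p : j ≺ N) → Univ (kits N j p) Γ t u → Univ (universe j) Γ t u
fromKit p = transport (λ 𝒰 → Univ 𝒰 _ _ _) (kits-universe p)

toKit : (p : j ≺ N) → Univ (universe j) Γ t u → Univ (kits N j p) Γ t u
toKit p = transport (λ 𝒰 → Univ 𝒰 _ _ _) (sym (kits-universe p))

-- Reducibility implies derivability

escapeTy : Γ ⊩⟨ N ⟩ A ∶ k → Γ ⊢ A ∶ sort k
escapeTy (⊩ne R _)     = lhs (typ R)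
escapeTy (⊩sort R _)   = lhs (typ R)
escapeTy (⊩pi R _ _ _) = lhs (typ R)

escapeEq : (p : Γ ⊩⟨ N ⟩ A ∶ k) → TyEq p B → Γ ⊢ A ≣ B ∶ sort k
escapeEq (⊩ne R _) (_ , R' , n)              = ≣-trans (typ R) (≣-trans (typ n) (≣-sym (typ R')))
escapeEq (⊩sort R _) R'                      = ≣-trans (typ R) (≣-sym (typ R'))
escapeEq (⊩pi R _ _ _) (_ , _ , R' , e , _)  = ≣-trans (typ R) (≣-trans e (≣-sym (typ R')))

escapeEl : (p : Γ ⊩⟨ N ⟩ A ∶ k) → El p t u → Γ ⊢ t ≣ u ∶ A
escapeEl (⊩ne _ _) (_ , _ , r , r' , n) = ≣-trans (typ r) (≣-trans (typ n) (≣-sym (typ r')))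
escapeEl (⊩sort R _) (e , _)            = ≣-conv⁻ e (typ R)
escapeEl (⊩pi _ _ _ _) (_ , _ , _ , _ , _ , _ , e , _) = e

Fam : ℕ → Ctx → Exp → ℕ → Set
Fam N Γ F i = ∀ {Δ ρ} → Ren Δ ρ Γ → Δ ⊩⟨ N ⟩ rename ρ F ∶ i

Fam₂ : ∀ a F → Fam N Γ F i → Exp → ℕ → Set
Fam₂ {N} {Γ} a F pF G j = ∀ {Δ ρ v} (r : Ren Δ ρ Γ) → Arg a F pF r v v → Δ ⊩⟨ N ⟩ rename (liftRen ρ) G [ v ] ∶ j

Fam₂-ext : ∀ a F (pF : Fam N Γ F i) G → Fam₂ a F pF G j → Set
Fam₂-ext {Γ = Γ} a F pF G pG = ∀ {Δ ρ v v'} (r : Ren Δ ρ Γ) (α : Arg a F pF r v v) → Arg a F pF r v v' →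
  TyEq (pG r α) (rename (liftRen ρ) G [ v' ])

FamEq : ∀ F → Fam N Γ F i → Exp → Set
FamEq {Γ = Γ} F pF F' = ∀ {Δ ρ} (r : Ren Δ ρ Γ) → TyEq (pF r) (rename ρ F')

Fam₂Eq : ∀ a F (pF : Fam N Γ F i) G → Fam₂ a F pF G j → Exp → Set
Fam₂Eq {Γ = Γ} a F pF G pG G' = ∀ {Δ ρ v} (r : Ren Δ ρ Γ) (α : Arg a F pF r v v) →
  TyEq (pG r α) (rename (liftRen ρ) G' [ v ])

-- Equal types have related derivations, with the same weak head normal form on the shared side.
data View : (p : Γ ⊩⟨ N ⟩ A ∶ k) (q : Γ ⊩⟨ M ⟩ B ∶ l) → TyEq p B → Set where
  ne   : ∀ {R : Γ ⊢ A ↘ K ∶ sort k} {n R' n' R″ m} →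
         View (⊩ne {N} {kits N} R n) (⊩ne {M} {kits M} {A = B} {K = F} {k = l} R' n') (F , R″ , m)
  sort : ∀ {R : Γ ⊢ A ↘ sort j ∶ sort (suc j)} {p R' p' R″} →
         View (⊩sort {N} {kits N} R p) (⊩sort {M} {kits M} {A = B} {j = j} R' p') R″
  pi   : ∀ {R : Γ ⊢ A ↘ pi a i j F G ∶ sort (i ⊔ j)} 
           {pF : Fam N Γ F i} {pG : Fam₂ a F pF G j} {x : Fam₂-ext a F pF G pG}
           {R' : Γ ⊢ B ↘ pi a i j F' G' ∶ sort (i ⊔ j)} {qF : Fam M Γ F' i} {qG : Fam₂ a F' qF G' j}
           {y : Fam₂-ext a F' qF G' qG} {R″ e} {eF : FamEq F pF F'} {eG : Fam₂Eq a F pF G pG G'} →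
         View (⊩pi {N} {kits N} R pF pG x) (⊩pi {M} {kits M} {A = B} {F = F'} {G = G'} R' qF qG y)
           (F' , G' , R″ , e , eF , eG)

view : (p : Γ ⊩⟨ N ⟩ A ∶ k) (q : Γ ⊩⟨ M ⟩ B ∶ l) (e : TyEq p B) → View p q e
view (⊩ne _ _) (⊩ne R n) (_ , R' , n')
  with refl ← ⟶*-det (red R) (red R') (~-neˡ n) (~-neʳ n') = ne
view (⊩ne _ _) (⊩sort R _) (_ , R' , n')
  with refl ← ⟶*-det (red R) (red R') sort (~-neʳ n') with (_ , ()) ← nfʳ n'
view (⊩ne _ _) (⊩pi R _ _ _) (_ , R' , n')
  with refl ← ⟶*-det (red R) (red R') pi (~-neʳ n') with (_ , ()) ← nfʳ n'
view (⊩sort _ _) (⊩ne R n) R'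
  with refl ← ⟶*-det (red R') (red R) sort (~-neˡ n) with (_ , ()) ← nfʳ n
view (⊩sort _ _) (⊩sort R _) R' with refl ← ⟶*-det (red R) (red R') sort sort = sort
view (⊩sort _ _) (⊩pi R _ _ _) R' with () ← ⟶*-det (red R) (red R') pi sort
view (⊩pi _ _ _ _) (⊩ne R n) (_ , _ , R' , _)
  with refl ← ⟶*-det (red R') (red R) pi (~-neˡ n) with (_ , ()) ← nfʳ n
view (⊩pi _ _ _ _) (⊩sort R _) (_ , _ , R' , _) with () ← ⟶*-det (red R) (red R') sort pi
view (⊩pi _ _ _ _) (⊩pi R _ _ _) (_ , _ , R' , _) with refl ← ⟶*-det (red R) (red R') pi pi = pi

-- The two directions are proved together because domains are contravariant. Symmetry of `TyEq`
-- cannot supply the second one: its proof converts arguments itself.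
conv  : (p : Γ ⊩⟨ N ⟩ A ∶ k) (q : Γ ⊩⟨ M ⟩ B ∶ l) → TyEq p B → El p t u → El q t u
conv⁻ : (p : Γ ⊩⟨ N ⟩ A ∶ k) (q : Γ ⊩⟨ M ⟩ B ∶ l) → TyEq p B → El q t u → El p t u
convArg  : ∀ a F F' (pF : Fam N Γ F i) (qF : Fam M Γ F' i) → FamEq F pF F' →
  (r : Ren Δ ρ Γ) → Arg a F pF r v v' → Arg a F' qF r v v'
convArg⁻ : ∀ a F F' (pF : Fam N Γ F i) (qF : Fam M Γ F' i) → FamEq F pF F' →
  (r : Ren Δ ρ Γ) → Arg a F' qF r v v' → Arg a F pF r v v'

convArg rel F F' pF qF e r (x , y , z) = conv (pF r) (qF r) (e r) x , conv (pF r) (qF r) (e r) y , conv (pF r) (qF r) (e r) z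
convArg irr F F' pF qF e r (x , y) =
  conv (pF (resurrect r)) (qF (resurrect r)) (e (resurrect r)) x , conv (pF (resurrect r)) (qF (resurrect r)) (e (resurrect r)) y

convArg⁻ rel F F' pF qF e r (x , y , z) = conv⁻ (pF r) (qF r) (e r) x , conv⁻ (pF r) (qF r) (e r) y , conv⁻ (pF r) (qF r) (e r) z
convArg⁻ irr F F' pF qF e r (x , y) =
  conv⁻ (pF (resurrect r)) (qF (resurrect r)) (e (resurrect r)) x , conv⁻ (pF (resurrect r)) (qF (resurrect r)) (e (resurrect r)) y

conv p q e h with escapeEq p e | view p q e
conv _ _ _ (k , k' , r , r' , n) | E | ne = k , k' , ↘-conv E r , ↘-conv E r' , ~-conv E n
conv (⊩sort _ p) (⊩sort _ q) _ (e , h) | E | sort = e , toKit q (fromKit p h)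
conv (⊩pi {a = a} {F = F} _ pF pG _) (⊩pi {F = F'} _ qF qG _) (_ , _ , _ , _ , eF , eG) (f , g , r , r' , ff , fg , e , h) | E | pi =
  f , g , ↘-conv E r , ↘-conv E r' , ff , fg , ≣-conv e E , λ s β β' →
    let α = convArg⁻ a F F' pF qF eF s β in
    conv (pG s α) (qG s β) (eG s α) (h s α (convArg⁻ a F F' pF qF eF s β'))

conv⁻ p q e h with ≣-sym (escapeEq p e) | view p q e
conv⁻ _ _ _ (k , k' , r , r' , n) | E | ne = k , k' , ↘-conv E r , ↘-conv E r' , ~-conv E n
conv⁻ (⊩sort _ p) (⊩sort _ q) _ (e , h) | E | sort = e , toKit p (fromKit q h)
conv⁻ (⊩pi {a = a} {F = F} _ pF pG _) (⊩pi {F = F'} _ qF qG _) (_ , _ , _ , _ , eF , eG) (f , g , r , r' , ff , fg , e , h) | E | pi =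
  f , g , ↘-conv E r , ↘-conv E r' , ff , fg , ≣-conv e E , λ s α α' →
    let β = convArg a F F' pF qF eF s α in
    conv⁻ (pG s α) (qG s β) (eG s α) (h s β (convArg a F F' pF qF eF s α'))

tyRefl : (p : Γ ⊩⟨ N ⟩ A ∶ k) → TyEq p A
tyRefl (⊩ne R n)          = _ , R , n
tyRefl (⊩sort R _)        = R
tyRefl (⊩pi R pF pG ext)  = _ , _ , R , ≣-refl (rhs (typ R)) , (λ r → tyRefl (pF r)) , λ r α → tyRefl (pG r α)

-- Elements depend neither on the derivation of their type nor on the universe bound. The equations
-- are there for renamed and substituted types, which often agree only propositionally.
irrelevance : (p : Γ ⊩⟨ N ⟩ A ∶ k) (q : Γ ⊩⟨ M ⟩ B ∶ l) → A ≐ B → t ≐ t' → u ≐ u' → El p t u → El q t' u'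
irrelevance p q refl refl refl = conv p q (tyRefl p)

-- The equation `k ≐ l` serves neutral types, whose sorts are shown unique only later; for universes
-- and function types the head fixes the sort.
tySym : (p : Γ ⊩⟨ N ⟩ A ∶ k) (q : Γ ⊩⟨ M ⟩ B ∶ l) → k ≐ l → TyEq p B → TyEq q A
tySym p q k≐l e with view p q e
tySym (⊩ne R _) (⊩ne _ _) refl (_ , R' , n) | ne = _ , R , ~-sym n
tySym (⊩sort R _) _ _ _ | sort = R
tySym (⊩pi {a = a} {F = F} R pF pG _) (⊩pi {F = F'} _ qF qG _) _ (_ , _ , _ , e , eF , eG) | pi =
  _ , _ , R , ≣-sym e , (λ r → tySym (pF r) (qF r) refl (eF r)) ,
  λ r β → tySym (pG r _) (qG r β) refl (eG r (convArg⁻ a F F' pF qF eF r β))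

tyTrans : (p : Γ ⊩⟨ N ⟩ A ∶ k) (q : Γ ⊩⟨ M ⟩ B ∶ l) → k ≐ l → TyEq p B → TyEq q C → TyEq p C
tyTrans p q k≐l e e' with view p q e
tyTrans (⊩ne _ _) (⊩ne _ _) refl (_ , _ , n) (_ , R' , n') | ne = _ , R' , ~-trans n n'
tyTrans (⊩sort _ _) _ _ _ e' | sort = e'
tyTrans (⊩pi {a = a} {F = F} R pF pG _) (⊩pi {F = F'} _ qF qG _) _ (_ , _ , _ , e , eF , eG) (_ , _ , R' , e' , eF' , eG') | pi =
  _ , _ , R' , ≣-trans e e' , (λ r → tyTrans (pF r) (qF r) refl (eF r) (eF' r)) ,
  λ r α → tyTrans (pG r α) (qG r _) refl (eG r α) (eG' r (convArg a F F' pF qF eF r α))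

tyIrrelevance : (p : Γ ⊩⟨ N ⟩ A ∶ k) (q : Γ ⊩⟨ M ⟩ A' ∶ k) → A ≐ A' → B ≐ B' → TyEq p B → TyEq q B'
tyIrrelevance p q refl refl = tyTrans q p refl (tyRefl q)

castTy : A ≐ B → Γ ⊩⟨ N ⟩ A ∶ k → Γ ⊩⟨ N ⟩ B ∶ k
castTy refl p = p

argL : ∀ a F (pF : Fam N Γ F i) (r : Ren Δ ρ Γ) → Arg a F pF r v v' → Arg a F pF r v v
argL rel F pF r (x , _) = x , x , x
argL irr F pF r (x , _) = x , x

argR : ∀ a F (pF : Fam N Γ F i) (r : Ren Δ ρ Γ) → Arg a F pF r v v' → Arg a F pF r v' v'
argR rel F pF r (_ , y , _) = y , y , y
argR irr F pF r (_ , y)     = y , y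

elSym : (p : Γ ⊩⟨ N ⟩ A ∶ k) → El p t u → El p u t
elSym (⊩ne _ _) (_ , _ , r , r' , n) = _ , _ , r' , r , ~-sym n
elSym (⊩sort _ p) (e , h) with fromKit p h
... | x , y , x≈y = ≣-sym e , toKit p (y , x , tySym x y refl x≈y)
elSym {t = t} {u} (⊩pi {a = a} {F = F} _ pF pG ext) (_ , _ , r , r' , ff , fg , e , h) =
  _ , _ , r' , r , fg , ff , ≣-sym e , λ s α α' →
    -- Symmetry exchanges the arguments as well, so the result lies in the codomain at `v'`; `ext`
    -- brings it back to `v`.
    conv⁻ (pG s α) (pG s (argR a F pF s α')) (ext s α α')
      (elSym (pG s _) (h s (argR a F pF s α') (swap a s α')))
  where
  swap : ∀ a {Δ ρ v v'} (r : Ren Δ ρ _) → Arg a F pF r v v' → Arg a F pF r v' v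
  swap rel r (x , y , z) = y , x , elSym (pF r) z
  swap irr r (x , y)     = y , x

elTrans : (p : Γ ⊩⟨ N ⟩ A ∶ k) → El p t u → El p u v → El p t v
elTrans (⊩ne _ _) (_ , _ , r , r₁ , n) (_ , _ , r₂ , r' , n')
  with refl ← ⟶*-det (red r₁) (red r₂) (~-neʳ n) (~-neˡ n') = _ , _ , r , r' , ~-trans n n'
elTrans (⊩sort _ p) (e , h) (e' , h') with fromKit p h | fromKit p h'
... | x , y , x≈y | y' , z , y≈z = ≣-trans e e' , toKit p (x , z , tyTrans x y' refl x≈y y≈z)
elTrans (⊩pi {a = a} {F = F} _ pF pG _) (_ , _ , r , _ , ff , _ , e , h) (_ , _ , _ , r' , _ , fg , e' , h') =
  _ , _ , r , r' , ff , fg , ≣-trans e e' , λ s α α' → elTrans (pG s α) (h s α α) (h' s α α')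

ann≡-refl : Γ ⊢ u ∶[ a ] A → Γ ⊢ u ≡ u ∶[ a ] A
ann≡-refl (ann-rel d) = eqann-rel (eq-refl d)
ann≡-refl (ann-irr d) = eqann-irr d d

record AnnEq (a : Ann) (Γ : Ctx) (u u' A : Exp) : Set where
  constructor annEq
  field
    annˡ : Γ ⊢ u ∶[ a ] A
    annʳ : Γ ⊢ u' ∶[ a ] A
    ann≡ : Γ ⊢ u ≡ u' ∶[ a ] A
open AnnEq

annEq-refl : Γ ⊢ u ∶[ a ] A → AnnEq a Γ u u A
annEq-refl d = annEq d d (ann≡-refl d)

escapeArg : ∀ a F (pF : Fam N Γ F i) (r : Ren Δ ρ Γ) → Arg a F pF r v v' → AnnEq a Δ v v' (rename ρ F)
escapeArg rel F pF r (_ , _ , z) with escapeEl (pF r) z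
... | ⟪ d , d' , e ⟫ = annEq (ann-rel d) (ann-rel d') (eqann-rel e)
escapeArg irr F pF r (x , y) with escapeEl (pF (resurrect r)) x | escapeEl (pF (resurrect r)) y
... | ⟪ d , _ , _ ⟫ | ⟪ d' , _ , _ ⟫ = annEq (ann-irr d) (ann-irr d') (eqann-irr d d')

app-≣ : Γ ⊢ t ≣ t' ∶ pi a i j F G → AnnEq a Γ v v' F → Γ ⊢ G [ v ] ≣ G [ v' ] ∶ sort k →
  Γ ⊢ app a t v ≣ app a t' v' ∶ G [ v ]
app-≣ ⟪ d , d' , e ⟫ (annEq x x' y) E = ⟪ ty-app d x , ty-conv (ty-app d' x') (eq-sym (equ E)) , eq-app e y ⟫

app-↘ : Γ ⊢ t ↘ t' ∶ pi a i j F G → Γ ⊢ v ∶[ a ] F → Γ ⊢ app a t v ↘ app a t' v ∶ G [ v ]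
app-↘ (r , ⟪ d , d' , e ⟫) x = appˡ* r , ⟪ ty-app d x , ty-app d' x , eq-app e (ann≡-refl x) ⟫

-- Closure under weak head expansion

tyExp : Γ ⊢ A' ↘ A ∶ sort k → Γ ⊩⟨ N ⟩ A ∶ k → Γ ⊩⟨ N ⟩ A' ∶ k
tyExp s (⊩ne R n)           = ⊩ne (↘-trans s R) n
tyExp s (⊩sort R p)         = ⊩sort (↘-trans s R) p
tyExp s (⊩pi R pF pG ext)   = ⊩pi (↘-trans s R) pF pG ext

tyEqExp : (p : Γ ⊩⟨ N ⟩ A ∶ k) → Γ ⊢ B' ↘ B ∶ sort k → TyEq p B → TyEq p B'
tyEqExp (⊩ne R n) s (_ , R' , m)               = _ , ↘-trans s R' , m
tyEqExp (⊩sort R p) s R'                       = ↘-trans s R'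
tyEqExp (⊩pi R pF pG ext) s (_ , _ , R' , e)   = _ , _ , ↘-trans s R' , e

elExp : (p : Γ ⊩⟨ N ⟩ A ∶ k) → Γ ⊢ t' ↘ t ∶ A → El p t u → El p t' u
elExp (⊩ne _ _) s (_ , _ , r , r' , n) = _ , _ , ↘-trans s r , r' , n
elExp (⊩sort R p) s (e , h) with fromKit p h
... | x , y , x≈y = ≣-trans (typ (↘-conv (typ R) s)) e ,
  toKit p (x' , y , tyTrans x' x refl (tySym x x' refl (tyEqExp x (↘-conv (typ R) s) (tyRefl x))) x≈y)
  where x' = tyExp (↘-conv (typ R) s) (proj₁ (fromKit p h))
elExp (⊩pi {a = a} {F = F} R pF pG _) s (_ , _ , r , r' , ff , fg , e , h) =
  _ , _ , ↘-trans s r , r' , ff , fg , ≣-trans (typ s) e , λ w α α' →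
    elExp (pG w α) (app-↘ (↘-conv (≣-ren (typ R) w) (↘-ren w s)) (annˡ (escapeArg a F pF w α))) (h w α α')

elExpʳ : (p : Γ ⊩⟨ N ⟩ A ∶ k) → Γ ⊢ u' ↘ u ∶ A → El p t u → El p t u'
elExpʳ p s h = elSym p (elExp p s (elSym p h))

-- Closure under renaming

argIrrelevance : ∀ a F F' {ρ ρ' Γ Γ'} (pF : Fam N Γ F i) (qF : Fam M Γ' F' j) (r : Ren Δ ρ Γ) (r' : Ren Δ ρ' Γ') →
  rename ρ F ≐ rename ρ' F' → Arg a F pF r v v' → Arg a F' qF r' v v'
argIrrelevance rel F F' pF qF r r' e (x , y , z) =
  irrelevance (pF r) (qF r') e refl refl x , irrelevance (pF r) (qF r') e refl refl y , irrelevance (pF r) (qF r') e refl refl z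
argIrrelevance irr F F' pF qF r r' e (x , y) =
  irrelevance (pF (resurrect r)) (qF (resurrect r')) e refl refl x , irrelevance (pF (resurrect r)) (qF (resurrect r')) e refl refl y

module _ {ρ : ℕ → ℕ} (r : Ren Δ ρ Γ) (F : Exp) (pF : Fam N Γ F i) where

  renFam : Fam N Δ (rename ρ F) i
  renFam s = castTy (sym (rename-rename _ ρ F)) (pF (ren-∘ s r))

  renArg : ∀ a {Θ ρ'} (s : Ren Θ ρ' Δ) → Arg a (rename ρ F) renFam s v v' → Arg a F pF (ren-∘ s r) v v'
  renArg a s = argIrrelevance a (rename ρ F) F renFam pF s (ren-∘ s r) (rename-rename _ ρ F)

tyRen : Γ ⊩⟨ N ⟩ A ∶ k → Ren Δ ρ Γ → Δ ⊩⟨ N ⟩ rename ρ A ∶ k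
tyRen (⊩ne R n) r   = ⊩ne (↘-ren r R) (~-ren r n)
tyRen (⊩sort R p) r = ⊩sort (↘-ren r R) p
tyRen {ρ = ρ} (⊩pi {a = a} {F = F} {G = G} R pF pG ext) r = ⊩pi (↘-ren r R) (renFam r F pF)
  (λ {_} {ρ'} {v} s β → castTy (sym (rename-lift-lift-single ρ' ρ v G)) (pG (ren-∘ s r) (renArg r F pF a s β)))
  (λ {_} {ρ'} {v} {v'} s β β' → tyIrrelevance (pG (ren-∘ s r) (renArg r F pF a s β)) _
    (sym (rename-lift-lift-single ρ' ρ v G)) (sym (rename-lift-lift-single ρ' ρ v' G))
    (ext (ren-∘ s r) (renArg r F pF a s β) (renArg r F pF a s β')))

tyEqRen : (p : Γ ⊩⟨ N ⟩ A ∶ k) (r : Ren Δ ρ Γ) → TyEq p B → TyEq (tyRen p r) (rename ρ B)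
tyEqRen (⊩ne R n) r (_ , R' , m) = _ , ↘-ren r R' , ~-ren r m
tyEqRen (⊩sort R p) r R'         = ↘-ren r R'
tyEqRen {ρ = ρ} (⊩pi {a = a} {F = F} {G = G} R pF pG ext) r (F' , G' , R' , e , eF , eG) =
  _ , _ , ↘-ren r R' , ≣-ren e r ,
  (λ {_} {ρ'} s → tyIrrelevance (pF (ren-∘ s r)) _ (sym (rename-rename ρ' ρ F)) (sym (rename-rename ρ' ρ F')) (eF (ren-∘ s r))) ,
  (λ {_} {ρ'} {v} s β → tyIrrelevance (pG (ren-∘ s r) (renArg r F pF a s β)) _
    (sym (rename-lift-lift-single ρ' ρ v G)) (sym (rename-lift-lift-single ρ' ρ v G'))
    (eG (ren-∘ s r) (renArg r F pF a s β)))

elRen : (p : Γ ⊩⟨ N ⟩ A ∶ k) (r : Ren Δ ρ Γ) → El p t u → El (tyRen p r) (rename ρ t) (rename ρ u)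
elRen (⊩ne _ _) r (_ , _ , s , s' , n) = _ , _ , ↘-ren r s , ↘-ren r s' , ~-ren r n
elRen (⊩sort _ p) r (e , h) with fromKit p h
... | x , y , x≈y = ≣-ren e r , toKit p (tyRen x r , tyRen y r , tyEqRen x r x≈y)
elRen {ρ = ρ} {t = t} {u = u} (⊩pi {a = a} {F = F} {G = G} R pF pG ext) r (_ , _ , s , s' , ff , fg , e , h) =
  _ , _ , ↘-ren r s , ↘-ren r s' , fun-ren ρ ff , fun-ren ρ fg , ≣-ren e r , λ {_} {ρ'} {v} {v'} w β β' →
    irrelevance (pG (ren-∘ w r) (renArg r F pF a w β)) _ (sym (rename-lift-lift-single ρ' ρ v G))
      (cong (λ x → app a x v) (sym (rename-rename ρ' ρ t))) (cong (λ x → app a x v') (sym (rename-rename ρ' ρ u)))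
      (h (ren-∘ w r) (renArg r F pF a w β) (renArg r F pF a w β'))

-- The bound on the universes may be lowered to the sort of the type.
relevel : Γ ⊩⟨ N ⟩ A ∶ k → k ≤ M → Γ ⊩⟨ M ⟩ A ∶ k
relevelFam : ∀ F → Fam N Γ F i → i ≤ M → Fam M Γ F i
relevelArg : ∀ a F (pF : Fam N Γ F i) (q : i ≤ M) (r : Ren Δ ρ Γ) →
  Arg a F (relevelFam F pF q) r v v' → Arg a F pF r v v'

relevelFam F pF q r = relevel (pF r) q

relevelArg a F pF q r = argIrrelevance a F F (relevelFam F pF q) pF r r refl

relevel (⊩ne R n) q   = ⊩ne R n
relevel (⊩sort R p) q = ⊩sort R (<⇒≺ q)
relevel {M = M} (⊩pi {a = a} {i} {j} {F} R pF pG ext) q = ⊩pi R (relevelFam F pF qi)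
  (λ r β → relevel (pG r (relevelArg a F pF qi r β)) qj)
  (λ r β β' → tyIrrelevance (pG r (relevelArg a F pF qi r β)) _ refl refl
    (ext r (relevelArg a F pF qi r β) (relevelArg a F pF qi r β')))
  where
  qi : i ≤ M
  qi = ℕₚ.≤-trans (ℕₚ.m≤m⊔n i j) q
  qj : j ≤ M
  qj = ℕₚ.≤-trans (ℕₚ.m≤n⊔m i j) q

-- Neutral terms are reducible, and reducible terms have normal forms

CommonNf : Exp → Exp → Set
CommonNf t u = ∃ λ n → (t ⇓ n) × (u ⇓ n)

nf-refl : Γ ⊢ t ~ u ∶ A → CommonNf t u
nf-refl (neEq _ (_ , d) (_ , d')) = _ , (_ , nf-ne done d) , (_ , nf-ne done d')

nf-exp₂ : t ⟶* t' → u ⟶* u' → CommonNf t' u' → CommonNf t u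
nf-exp₂ r r' (_ , (_ , d) , (_ , d')) = _ , (_ , nf-exp r d) , (_ , nf-exp r' d')

nf-sort₂ : t ⟶* sort j → u ⟶* sort j → CommonNf t u
nf-sort₂ r r' = _ , (_ , nf-sort r) , (_ , nf-sort r')

CommonNf-resp : t ≐ t' → u ≐ u' → CommonNf t u → CommonNf t' u'
CommonNf-resp refl refl h = h

famTy : ⊢ Γ → Fam N Γ F i → Γ ⊢ F ∶ sort i
famTy {F = F} w pF = ⊢-ty (rename-idᶠ F) refl (escapeTy (pF (id-ren w)))

-- At a function type, reflection needs normal forms of relevant arguments, and reification applies
-- the function to a reflected fresh variable. Elements of a universe are types with a smaller
-- bound; the accessibility argument covers that step.
reflect : Acc _≺_ N → (p : Γ ⊩⟨ N ⟩ A ∶ k) → Γ ⊢ t ~ u ∶ A → El p t u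
reify   : Acc _≺_ N → (p : Γ ⊩⟨ N ⟩ A ∶ k) → El p t u → CommonNf t u
reifyTy : Acc _≺_ N → (p : Γ ⊩⟨ N ⟩ A ∶ k) → TyEq p B → CommonNf A B
reflectVar : Acc _≺_ N → ∀ a F (pF : Fam N Γ F i) (w : ⊢ (Γ ▸ (a , F))) → Arg a F pF (wk-ren w) (var 0) (var 0)
reifyApp : Acc _≺_ N → ∀ a F (pF : Fam N Γ F i) (r : Ren Δ ρ Γ) → Nfⁿ s t e → Nfⁿ s' u e → Arg a F pF r v v' →
  ∃ λ m → (app a t v ⇓ⁿ m) × (app a u v' ⇓ⁿ m)

reflectVar ac rel F pF w = h , h , h
  where h = reflect ac (pF (wk-ren w)) (neEq (≣-refl (ty-var w here)) (_ , nf-var) (_ , nf-var))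
reflectVar ac irr F pF w = h , h
  where h = reflect ac (pF (resurrect (wk-ren w))) (neEq (≣-refl (ty-var (⊢-⊕ w) here)) (_ , nf-var) (_ , nf-var))

reifyApp ac rel F pF r d d' (_ , _ , z) with reify ac (pF r) z
... | _ , (_ , x) , (_ , y) = _ , (_ , nf-app d x) , (_ , nf-app d' y)
reifyApp ac irr F pF r d d' _ = _ , (_ , nf-appⁱ d) , (_ , nf-appⁱ d')

reflect ac (⊩ne R n) m   = _ , _ , ↘-refl (lhs (typ m)) , ↘-refl (rhs (typ m)) , m
reflect ac (⊩sort R p) m = typ m' ,
  toKit p (⊩ne (↘-refl (lhs (typ m'))) (~-trans m' (~-sym m')) , ⊩ne (↘-refl (rhs (typ m'))) (~-trans (~-sym m') m') ,
    (_ , ↘-refl (rhs (typ m')) , m'))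
  where m' = ~-conv (typ R) m
reflect ac (⊩pi {a = a} {F = F} R pF pG ext) m =
  _ , _ , ↘-refl (lhs (typ m)) , ↘-refl (rhs (typ m)) , ne (nfˡ m) , ne (nfʳ m) , typ m , λ {_} {ρ} r α α' →
    let _ , x , y = reifyApp ac a F pF r (nfⁿ-ren ρ (proj₂ (nfˡ m))) (nfⁿ-ren ρ (proj₂ (nfʳ m))) α' in
    reflect ac (pG r α) (neEq (app-≣ (≣-conv (≣-ren (typ m) r) (≣-ren (typ R) r)) (escapeArg a F pF r α')
      (escapeEq (pG r α) (ext r α α'))) x y)

reify ac (⊩ne _ _) (_ , _ , r , r' , n) = nf-exp₂ (red r) (red r') (nf-refl n)
reify (acc rs) (⊩sort _ p) (_ , h) with fromKit p h
... | x , _ , x≈y = reifyTy (rs p) x x≈y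
reify ac (⊩pi {a = a} {i = i} {F = F} R pF pG ext) (_ , _ , r , r' , ff , fg , e , h)
  with w ← ctx-▸ {a = a} (ty-wf (lhs e)) (famTy {F = F} (ty-wf (lhs e)) pF)
  with α ← reflectVar ac a F pF w
  with n , d , d' ← reify ac (pG (wk-ren w) α) (h (wk-ren w) α α)
  with m , v ← η-view a n = m , nf-fun (red r) ff d v , nf-fun (red r') fg d' v

reifyTy ac (⊩ne R n) (_ , R' , m) = nf-exp₂ (red R) (red R') (nf-refl m)
reifyTy ac (⊩sort R p) R' = nf-sort₂ (red R) (red R')
reifyTy ac (⊩pi {a = a} {F = F} {G = G} R pF pG ext) (F' , G' , R' , e , eF , eG)
  with w ← ctx-▸ {a = a} (ty-wf (lhs e)) (famTy {F = F} (ty-wf (lhs e)) pF)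
  with α ← reflectVar ac a F pF w
  with _ , (_ , f) , (_ , f') ← CommonNf-resp (rename-idᶠ F) (rename-idᶠ F')
         (reifyTy ac (pF (id-ren (ty-wf (lhs e)))) (eF (id-ren (ty-wf (lhs e)))))
     | _ , (_ , g) , (_ , g') ← CommonNf-resp (rename-lift-wk-var0 G) (rename-lift-wk-var0 G')
         (reifyTy ac (pG (wk-ren w) α) (eG (wk-ren w) α))
  = _ , (_ , nf-pi (red R) f g) , (_ , nf-pi (red R') f' g')

-- Semantic equality

_⊩_≈_∶_ : Ctx → Exp → Exp → ℕ → Set
Γ ⊩ A ≈ B ∶ k = Univ (universe k) Γ A B

-- Heterogeneous, since under two related substitutions the sides have the types `subst σ A` and
-- `subst σ' A`. The bound is normalised to the sort of the type.
record Sem (Γ : Ctx) (t u A B : Exp) : Set where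
  constructor sem
  field
    {lvl} : ℕ
    tyˡ   : Γ ⊩⟨ lvl ⟩ A ∶ lvl
    tyʳ   : Γ ⊩⟨ lvl ⟩ B ∶ lvl
    ty≈   : TyEq tyˡ B
    el    : El tyˡ t u
open Sem

infix 4 _⊩_≈_∶_

sem-resp : t ≐ t' → u ≐ u' → A ≐ A' → B ≐ B' → Sem Γ t u A B → Sem Γ t' u' A' B'
sem-resp refl refl refl refl h = h

univ-resp : A ≐ A' → B ≐ B' → Γ ⊩ A ≈ B ∶ k → Γ ⊩ A' ≈ B' ∶ k
univ-resp refl refl h = h

sem-sym : Sem Γ t u A B → Sem Γ u t B A
sem-sym (sem p q e h) = sem q p (tySym p q refl e) (conv p q e (elSym p h))

sem-trans : Sem Γ t u A B → Sem Γ u v B C → Sem Γ t v A B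
sem-trans (sem p q e h) (sem p' _ _ h') = sem p q e (elTrans p h (conv⁻ p p' e h'))

sem-reflˡ : Sem Γ t u A B → Sem Γ t t A A
sem-reflˡ (sem p q e h) = sem p p (tyRefl p) (elTrans p h (elSym p h))

sem-reflʳ : Sem Γ t u A B → Sem Γ u u B B
sem-reflʳ h = sem-reflˡ (sem-sym h)

sem-ren : Sem Γ t u A B → Ren Δ ρ Γ → Sem Δ (rename ρ t) (rename ρ u) (rename ρ A) (rename ρ B)
sem-ren (sem p q e h) r = sem (tyRen p r) (tyRen q r) (tyEqRen p r e) (elRen p r h)

sem-≣ : Sem Γ t u A B → Γ ⊢ t ≣ u ∶ A
sem-≣ (sem p _ _ h) = escapeEl p h

univ-≣ : Γ ⊩ A ≈ B ∶ k → Γ ⊢ A ≣ B ∶ sort k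
univ-≣ (p , _ , e) = escapeEq p e

sem-conv : Sem Γ t u A A' → Γ ⊩ A ≈ B ∶ k → Γ ⊩ B ≈ B' ∶ k → Sem Γ t u B B'
sem-conv (sem p _ _ h) (q , q' , e) (x , y , f) =
  sem x y f (irrelevance q' x refl refl refl (conv q q' e (irrelevance p q refl refl refl h)))

sort-sem : ⊢ Γ → Γ ⊩ A ≈ B ∶ k → Sem Γ A B (sort k) (sort k)
sort-sem w h = sem p p (tyRefl p) (univ-≣ h , toKit base h)
  where p = ⊩sort (↘-refl (ty-sort w)) base

sem-sort : Sem Γ A B (sort k) (sort k) → Γ ⊩ A ≈ B ∶ k
sem-sort (sem (⊩ne R n) _ _ _)
  with refl ← ⟶*-det done (red R) sort (~-neˡ n) with (_ , ()) ← nfˡ n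
sem-sort (sem (⊩pi R _ _ _) _ _ _) with () ← ⟶*-det done (red R) sort pi
sem-sort (sem (⊩sort R p) _ _ (_ , h)) with refl ← ⟶*-det done (red R) sort sort = fromKit p h

AnnSem : Ann → Ctx → Exp → Exp → Exp → Exp → Set
AnnSem rel Γ u v A B = Sem Γ u v A B
AnnSem irr Γ u v A B = Sem (Γ ⊕) u u A A × Sem (Γ ⊕) v v B B

annSem-resp : ∀ a → t ≐ t' → u ≐ u' → A ≐ A' → B ≐ B' → AnnSem a Γ t u A B → AnnSem a Γ t' u' A' B'
annSem-resp a refl refl refl refl h = h

-- Semantic substitutions; an irrelevant variable only has to be interpreted after resurrection.
record Sub (Δ : Ctx) (σ σ' : ℕ → Exp) (Γ : Ctx) : Set where
  constructor mkSub
  field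
    ⊢sub   : ⊢ Δ
    sub-∋  : ∀ {x A} → Γ ∋ x ∶ A → Sem Δ (σ x) (σ' x) (subst σ A) (subst σ' A)
    sub-∋⊕ : ∀ {x A} → Γ ⊕ ∋ x ∶ A →
      Sem (Δ ⊕) (σ x) (σ x) (subst σ A) (subst σ A) × Sem (Δ ⊕) (σ' x) (σ' x) (subst σ' A) (subst σ' A)
open Sub

sub-sym : Sub Δ σ σ' Γ → Sub Δ σ' σ Γ
sub-sym s = mkSub (⊢sub s) (λ h → sem-sym (sub-∋ s h)) (λ h → let x , y = sub-∋⊕ s h in y , x)

sub-reflˡ : Sub Δ σ σ' Γ → Sub Δ σ σ Γ
sub-reflˡ s = mkSub (⊢sub s) (λ h → sem-reflˡ (sub-∋ s h)) (λ h → let x , _ = sub-∋⊕ s h in x , x)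

sub-reflʳ : Sub Δ σ σ' Γ → Sub Δ σ' σ' Γ
sub-reflʳ s = sub-reflˡ (sub-sym s)

sub-resp : (∀ x → σ x ≐ τ x) → (∀ x → σ' x ≐ σ″ x) → Sub Δ σ σ' Γ → Sub Δ τ σ″ Γ
sub-resp e e' s = mkSub (⊢sub s)
  (λ {x} {A} h → sem-resp (e x) (e' x) (subst-cong e A) (subst-cong e' A) (sub-∋ s h))
  (λ {x} {A} h → let y , z = sub-∋⊕ s h in
    sem-resp (e x) (e x) (subst-cong e A) (subst-cong e A) y ,
    sem-resp (e' x) (e' x) (subst-cong e' A) (subst-cong e' A) z)

sub-ren : ∀ {Θ} → Sub Δ σ σ' Γ → Ren Θ ρ Δ → Sub Θ (rename ρ ∘ σ) (rename ρ ∘ σ') Γ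
sub-ren {σ = σ} {σ' = σ'} {ρ = ρ} s r = mkSub (⊢cod r)
  (λ {_} {A} h → sem-resp refl refl (rename-subst ρ σ A) (rename-subst ρ σ' A) (sem-ren (sub-∋ s h) r))
  (λ {_} {A} h → let y , z = sub-∋⊕ s h in
    sem-resp refl refl (rename-subst ρ σ A) (rename-subst ρ σ A) (sem-ren y (ren-⊕ r)) ,
    sem-resp refl refl (rename-subst ρ σ' A) (rename-subst ρ σ' A) (sem-ren z (ren-⊕ r)))

sem-ctx : Γ ≐ Δ → Sem Γ t u A B → Sem Δ t u A B
sem-ctx refl h = h

-- Only the diagonal survives resurrection, because `σ` and `σ'` need not be related at irrelevant
-- variables. An irrelevant premise is therefore used once for each substitution.
sub-⊕ : Sub Δ σ σ' Γ → Sub (Δ ⊕) σ σ (Γ ⊕)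
sub-⊕ {Δ} {Γ = Γ} s = mkSub (⊢-⊕ (⊢sub s)) (λ h → proj₁ (sub-∋⊕ s h))
  (λ h → let y = sem-ctx (sym (⊕-idem Δ)) (proj₁ (sub-∋⊕ s (∋-resp (⊕-idem Γ) h))) in y , y)

sem-⊕ : ⊢ Γ → Sem Γ t u A B → Sem (Γ ⊕) t u A B
sem-⊕ {t = t} {u} {A} {B} w h = sem-resp (rename-idᶠ t) (rename-idᶠ u) (rename-idᶠ A) (rename-idᶠ B)
  (sem-ren h (resurrect-id (⊢-⊕ w)))

sub-∷ : ∀ a → Sub Δ σ σ' Γ → AnnSem a Δ u u' (subst σ U) (subst σ' U) → Sub Δ (σ ∷ˢ u) (σ' ∷ˢ u') (Γ ▸ (a , U))
sub-∷ {Δ} {σ} {σ'} {Γ} {u} {u'} {U} a s h = mkSub (⊢sub s) (at a h) (at⊕ a h)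
  where
  wk-∷ : ∀ σ u A → subst σ A ≐ subst (σ ∷ˢ u) (wk A)
  wk-∷ σ u A = sym (subst-rename _ _ A)
  at : ∀ a → AnnSem a Δ u u' (subst σ U) (subst σ' U) → ∀ {x A} → (Γ ▸ (a , U)) ∋ x ∶ A →
    Sem Δ ((σ ∷ˢ u) x) ((σ' ∷ˢ u') x) (subst (σ ∷ˢ u) A) (subst (σ' ∷ˢ u') A)
  at rel h here = sem-resp refl refl (wk-∷ _ _ U) (wk-∷ _ _ U) h
  at a   h (there {U = A} x) = sem-resp refl refl (wk-∷ _ _ A) (wk-∷ _ _ A) (sub-∋ s x)
  at⊕ : ∀ a → AnnSem a Δ u u' (subst σ U) (subst σ' U) → ∀ {x A} → (Γ ⊕ ▸ (rel , U)) ∋ x ∶ A →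
    Sem (Δ ⊕) ((σ ∷ˢ u) x) ((σ ∷ˢ u) x) (subst (σ ∷ˢ u) A) (subst (σ ∷ˢ u) A) ×
    Sem (Δ ⊕) ((σ' ∷ˢ u') x) ((σ' ∷ˢ u') x) (subst (σ' ∷ˢ u') A) (subst (σ' ∷ˢ u') A)
  at⊕ rel h here =
    sem-resp refl refl (wk-∷ _ _ U) (wk-∷ _ _ U) (sem-reflˡ (sem-⊕ (⊢sub s) h)) ,
    sem-resp refl refl (wk-∷ _ _ U) (wk-∷ _ _ U) (sem-reflʳ (sem-⊕ (⊢sub s) h))
  at⊕ irr (h , h') here =
    sem-resp refl refl (wk-∷ _ _ U) (wk-∷ _ _ U) h , sem-resp refl refl (wk-∷ _ _ U) (wk-∷ _ _ U) h'
  at⊕ a h (there {U = A} x) = let y , z = sub-∋⊕ s x in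
    sem-resp refl refl (wk-∷ _ _ A) (wk-∷ _ _ A) y , sem-resp refl refl (wk-∷ _ _ A) (wk-∷ _ _ A) z

reflect-var : ∀ a → ⊢ (Γ ▸ (a , U)) → (∀ {Δ ρ} → Ren Δ ρ Γ → Δ ⊩ rename ρ U ≈ rename ρ U' ∶ k) →
  AnnSem a (Γ ▸ (a , U)) (var 0) (var 0) (wk U) (wk U')
reflect-var rel w f = let p , q , e = f (wk-ren w) in
  sem p q e (reflect (≺-acc _) p (neEq (≣-refl (ty-var w here)) (_ , nf-var) (_ , nf-var)))
reflect-var irr w f = let p , q , e = f (resurrect (wk-ren w))
                          h = reflect (≺-acc _) p (neEq (≣-refl (ty-var (⊢-⊕ w) here)) (_ , nf-var) (_ , nf-var)) in
  sem p p (tyRefl p) h , sem q q (tyRefl q) (conv p q e h)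

-- Validity

infix 4 _⊨_≡_∶_ _⊨_≡_∶[_]_
record _⊨_≡_∶_ (Γ : Ctx) (t u A : Exp) : Set where
  constructor valid
  field
    at : ∀ {Δ σ σ'} → Sub Δ σ σ' Γ → Sem Δ (subst σ t) (subst σ' u) (subst σ A) (subst σ' A)
open _⊨_≡_∶_

record _⊨_≡_∶[_]_ (Γ : Ctx) (t u : Exp) (a : Ann) (A : Exp) : Set where
  constructor valid
  field
    at : ∀ {Δ σ σ'} → Sub Δ σ σ' Γ → AnnSem a Δ (subst σ t) (subst σ' u) (subst σ A) (subst σ' A)
open _⊨_≡_∶[_]_ renaming (at to atᵃ)

⊨-sym : Γ ⊨ t ≡ u ∶ A → Γ ⊨ u ≡ t ∶ A
⊨-sym h = valid λ s → sem-sym (at h (sub-sym s))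

⊨-trans : Γ ⊨ t ≡ u ∶ A → Γ ⊨ u ≡ v ∶ A → Γ ⊨ t ≡ v ∶ A
⊨-trans h h' = valid λ s → sem-trans (at h s) (at h' (sub-reflʳ s))

⊨-reflˡ : Γ ⊨ t ≡ u ∶ A → Γ ⊨ t ≡ t ∶ A
⊨-reflˡ h = ⊨-trans h (⊨-sym h)

⊨-reflʳ : Γ ⊨ t ≡ u ∶ A → Γ ⊨ u ≡ u ∶ A
⊨-reflʳ h = ⊨-trans (⊨-sym h) h

⊨ann-reflˡ : ∀ a → Γ ⊨ t ≡ u ∶[ a ] A → Γ ⊨ t ≡ t ∶[ a ] A
⊨ann-reflˡ rel h = valid λ s → sem-trans (atᵃ h s) (sem-sym (atᵃ h (sub-reflʳ s)))
⊨ann-reflˡ irr h = valid λ s → proj₁ (atᵃ h s) , proj₁ (atᵃ h (sub-reflʳ s))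

⊨-univ : Γ ⊨ A ≡ B ∶ sort k → Sub Δ σ σ' Γ → Δ ⊩ subst σ A ≈ subst σ' B ∶ k
⊨-univ h s = sem-sort (at h s)

univ-⊨ : (∀ {Δ σ σ'} → Sub Δ σ σ' Γ → Δ ⊩ subst σ A ≈ subst σ' B ∶ k) → Γ ⊨ A ≡ B ∶ sort k
univ-⊨ h = valid λ s → sort-sem (⊢sub s) (h s)

⊨-univ-ren : ∀ {Θ} → Γ ⊨ A ≡ B ∶ sort k → Sub Δ σ σ' Γ → Ren Θ ρ Δ →
  Θ ⊩ rename ρ (subst σ A) ≈ rename ρ (subst σ' B) ∶ k
⊨-univ-ren {A = A} {B = B} h s r =
  univ-resp (sym (rename-subst _ _ A)) (sym (rename-subst _ _ B)) (⊨-univ h (sub-ren s r))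

⊨-conv : Γ ⊨ t ≡ u ∶ A → Γ ⊨ A ≡ B ∶ sort k → Γ ⊨ t ≡ u ∶ B
⊨-conv h e = valid λ s → sem-conv (at h s) (⊨-univ e (sub-reflˡ s)) (⊨-univ (⊨-reflʳ e) s)

sub-lift : Γ ⊨ U ≡ U ∶ sort k → Sub Δ σ σ' Γ → Sub (Δ ▸ (a , subst σ U)) (liftSub σ) (liftSub σ') (Γ ▸ (a , U))
sub-lift {U = U} {a = a} h s =
  sub-resp (λ { zero → refl ; (suc _) → refl }) (λ { zero → refl ; (suc _) → refl })
    (sub-∷ {u = var 0} {u' = var 0} {U = U} a (sub-ren s (wk-ren w))
      (annSem-resp a refl refl (rename-subst _ _ U) (rename-subst _ _ U) (reflect-var a w (⊨-univ-ren h s))))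
  where w = ctx-▸ {a = a} (⊢sub s) (lhs (univ-≣ (⊨-univ h s)))

tail-∷ : ∀ (σ : ℕ → Exp) x → ((σ ∘ suc) ∷ˢ σ 0) x ≐ σ x
tail-∷ σ zero    = refl
tail-∷ σ (suc x) = refl

sub-tail : Sub Δ σ σ' (Γ ▸ (a , U)) → Sub Δ (σ ∘ suc) (σ' ∘ suc) Γ
sub-tail s = mkSub (⊢sub s)
  (λ {_} {A} h → sem-resp refl refl (subst-rename _ _ A) (subst-rename _ _ A) (sub-∋ s (there h)))
  (λ {_} {A} h → let y , z = sub-∋⊕ s (there h) in
    sem-resp refl refl (subst-rename _ _ A) (subst-rename _ _ A) y ,
    sem-resp refl refl (subst-rename _ _ A) (subst-rename _ _ A) z)

sub-head : ∀ a → Sub Δ σ σ' (Γ ▸ (a , U)) → AnnSem a Δ (σ 0) (σ' 0) (subst (σ ∘ suc) U) (subst (σ' ∘ suc) U)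
sub-head {U = U} rel s = sem-resp refl refl (subst-rename _ _ U) (subst-rename _ _ U) (sub-∋ s here)
sub-head {U = U} irr s = let y , z = sub-∋⊕ s here in
  sem-resp refl refl (subst-rename _ _ U) (subst-rename _ _ U) y ,
  sem-resp refl refl (subst-rename _ _ U) (subst-rename _ _ U) z

sub-ctx : Γ ⊨ U' ≡ U ∶ sort k → Sub Δ σ σ' (Γ ▸ (a , U)) → Sub Δ σ σ' (Γ ▸ (a , U'))
sub-ctx {Γ} {U'} {U} {k} {Δ} {σ} {σ'} {a = a} e s =
  sub-resp (tail-∷ σ) (tail-∷ σ') (sub-∷ {U = U'} a (sub-tail s) (cv a (sub-head {U = U} a s)))
  where
  U≈U' : Γ ⊨ U ≡ U' ∶ sort k
  U≈U' = ⊨-sym e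
  U'≈U' : Γ ⊨ U' ≡ U' ∶ sort k
  U'≈U' = ⊨-reflˡ e
  cv1 : ∀ {Δ σ σ' t u} → Sub Δ σ σ' Γ → Sem Δ t u (subst σ U) (subst σ' U) → Sem Δ t u (subst σ U') (subst σ' U')
  cv1 s h = sem-conv h (⊨-univ U≈U' (sub-reflˡ s)) (⊨-univ U'≈U' s)
  cv : ∀ a → AnnSem a Δ (σ 0) (σ' 0) (subst (σ ∘ suc) U) (subst (σ' ∘ suc) U) →
    AnnSem a Δ (σ 0) (σ' 0) (subst (σ ∘ suc) U') (subst (σ' ∘ suc) U')
  cv rel h = cv1 (sub-tail s) h
  cv irr (h , h') = cv1 (sub-ren⊕ (sub-reflˡ (sub-tail s))) h , cv1 (sub-ren⊕ (sub-reflʳ (sub-tail s))) h'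
    where
    sub-ren⊕ : ∀ {σ σ'} → Sub Δ σ σ' Γ → Sub (Δ ⊕) σ σ' Γ
    sub-ren⊕ s = sub-resp (λ x → rename-idᶠ _) (λ x → rename-idᶠ _) (sub-ren s (resurrect-id (⊢-⊕ (⊢sub s))))

-- Semantic typing rules

argSem : ∀ a {Θ F F'} (pF : Fam N Δ F i) → (∀ {Θ ρ} → Ren Θ ρ Δ → Θ ⊩ rename ρ F ≈ rename ρ F' ∶ k) →
  (r : Ren Θ ρ Δ) → Arg a F pF r v v' → AnnSem a Θ v v' (rename ρ F) (rename ρ F')
argSem rel pF f r (_ , _ , z) = let p , q , e = f r in sem p q e (irrelevance (pF r) p refl refl refl z)
argSem irr pF f r (x , y) = let p , q , e = f (resurrect r) in
  sem p p (tyRefl p) (irrelevance (pF (resurrect r)) p refl refl refl x) ,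
  sem q q (tyRefl q) (conv p q e (irrelevance (pF (resurrect r)) p refl refl refl y))

semArg : ∀ a F F' {Θ} (pF : Fam N Δ F i) → FamEq F pF F' → (r : Ren Θ ρ Δ) →
  AnnSem a Θ v v' (rename ρ F) (rename ρ F') → Arg a F pF r v v'
semArg rel F F' pF eF r (sem p _ _ h) =
  irrelevance p (pF r) refl refl refl (elTrans p h (elSym p h)) ,
  irrelevance p (pF r) refl refl refl (elTrans p (elSym p h) h) ,
  irrelevance p (pF r) refl refl refl h
semArg irr F F' pF eF r (sem p _ _ h , sem q _ _ h') =
  irrelevance p (pF (resurrect r)) refl refl refl h , conv⁻ (pF (resurrect r)) q (eF (resurrect r)) h'

sub-arg : ∀ a {Θ} → Γ ⊨ U ≡ U ∶ sort k → Sub Δ σ σ' Γ → (pF : Fam N Δ (subst σ U) i) (r : Ren Θ ρ Δ) →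
  Arg a (subst σ U) pF r v v' → Sub Θ ((rename ρ ∘ σ) ∷ˢ v) ((rename ρ ∘ σ') ∷ˢ v') (Γ ▸ (a , U))
sub-arg {U = U} {σ = σ} {σ' = σ'} a ⊨U s pF r α = sub-∷ a (sub-ren s r)
  (annSem-resp a refl refl (rename-subst _ σ U) (rename-subst _ σ' U)
    (argSem a {F = subst σ U} {F' = subst σ' U} pF (⊨-univ-ren ⊨U s) r α))

module _ {a : Ann} (⊨U : Γ ⊨ U ≡ U ∶ sort i) (⊨T : (Γ ▸ (a , U)) ⊨ T ≡ T ∶ sort j) (s : Sub Δ σ σ Γ) where

  piFam : Fam (i ⊔ j) Δ (subst σ U) i
  piFam r = relevel (proj₁ (⊨-univ-ren ⊨U s r)) (ℕₚ.m≤m⊔n i j)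

  piFam₂ : Fam₂ a (subst σ U) piFam (subst (liftSub σ) T) j
  piFam₂ {_} {ρ} {v} r α = castTy (sym (rename-lift-subst-single ρ σ v T))
    (relevel (proj₁ (⊨-univ ⊨T (sub-arg a ⊨U s piFam r α))) (ℕₚ.m≤n⊔m i j))

  piTy : Δ ⊩⟨ i ⊔ j ⟩ pi a i j (subst σ U) (subst (liftSub σ) T) ∶ i ⊔ j
  piTy = ⊩pi
    (↘-refl (ty-pi (lhs (univ-≣ (⊨-univ ⊨U s))) (lhs (univ-≣ (⊨-univ ⊨T (sub-lift ⊨U s))))))
    piFam piFam₂
    -- Validity is binary: instantiated with substitutions that differ only in the last component,
    -- it gives extensionality of the codomain.
    (λ {_} {ρ} {v} {v'} r α α' → tyIrrelevance (proj₁ (⊨-univ ⊨T (sub-arg a ⊨U s piFam r α'))) (piFam₂ r α)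
      (sym (rename-lift-subst-single ρ σ v T)) (sym (rename-lift-subst-single ρ σ v' T))
      (proj₂ (proj₂ (⊨-univ ⊨T (sub-arg a ⊨U s piFam r α')))))

⊨-ctx : Γ ⊨ U' ≡ U ∶ sort k → (Γ ▸ (a , U')) ⊨ t ≡ u ∶ A → (Γ ▸ (a , U)) ⊨ t ≡ u ∶ A
⊨-ctx e h = valid λ s → at h (sub-ctx e s)

univ-pi : Γ ⊨ U ≡ U' ∶ sort i → (Γ ▸ (a , U)) ⊨ T ≡ T' ∶ sort j → Sub Δ σ σ' Γ →
  Δ ⊩ pi a i j (subst σ U) (subst (liftSub σ) T) ≈ pi a i j (subst σ' U') (subst (liftSub σ') T') ∶ i ⊔ j
univ-pi {Γ} {U} {U'} {i} {a} {T} {T'} {j} {Δ} {σ} {σ'} ⊨U ⊨T s = P , P' , _ , _ , ↘-refl (escapeTy P') ,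
  ⟪ escapeTy P , escapeTy P' , eq-pi (equ (univ-≣ (⊨-univ ⊨U s))) (equ (univ-≣ (⊨-univ ⊨T (sub-lift ⊨U₀ s)))) ⟫ ,
  (λ r → tyIrrelevance (proj₁ (⊨-univ-ren ⊨U s r)) (piFam ⊨U₀ ⊨T₀ s₀ r) refl refl (proj₂ (proj₂ (⊨-univ-ren ⊨U s r)))) ,
  λ {_} {ρ} {v} r α →
    tyIrrelevance (proj₁ (⊨-univ ⊨T (sub-arg a ⊨U₀ s (piFam ⊨U₀ ⊨T₀ s₀) r α))) (piFam₂ ⊨U₀ ⊨T₀ s₀ r α)
      (sym (rename-lift-subst-single ρ σ v T)) (sym (rename-lift-subst-single ρ σ' v T'))
      (proj₂ (proj₂ (⊨-univ ⊨T (sub-arg a ⊨U₀ s (piFam ⊨U₀ ⊨T₀ s₀) r α))))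
  where
  ⊨U₀ : Γ ⊨ U ≡ U ∶ sort i
  ⊨U₀ = ⊨-reflˡ ⊨U
  ⊨T₀ : (Γ ▸ (a , U)) ⊨ T ≡ T ∶ sort j
  ⊨T₀ = ⊨-reflˡ ⊨T
  s₀ : Sub Δ σ σ Γ
  s₀ = sub-reflˡ s
  P = piTy ⊨U₀ ⊨T₀ s₀
  P' = piTy (⊨-reflʳ ⊨U) (⊨-ctx ⊨U (⊨-reflʳ ⊨T)) (sub-reflʳ s)

⊨-pi : Γ ⊨ U ≡ U' ∶ sort i → (Γ ▸ (a , U)) ⊨ T ≡ T' ∶ sort j → Γ ⊨ pi a i j U T ≡ pi a i j U' T' ∶ sort (i ⊔ j)
⊨-pi ⊨U ⊨T = univ-⊨ (univ-pi ⊨U ⊨T)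

⊨-sort : Γ ⊨ sort k ≡ sort k ∶ sort (suc k)
⊨-sort = univ-⊨ λ s → let p = ⊩sort (↘-refl (ty-sort (⊢sub s))) base in p , p , tyRefl p

⊨-var : ∀ {x} → Γ ∋ x ∶ A → Γ ⊨ var x ≡ var x ∶ A
⊨-var h = valid λ s → sub-∋ s h

data IsPi : Γ ⊩⟨ N ⟩ pi a i j F G ∶ k → Set where
  isPi : ∀ {R : Γ ⊢ pi a i j F G ↘ pi a i j F G ∶ sort (i ⊔ j)} {pF : Fam N Γ F i} {pG : Fam₂ a F pF G j} {ext : Fam₂-ext a F pF G pG} →
         IsPi (⊩pi R pF pG ext)

pi-view : (p : Γ ⊩⟨ N ⟩ pi a i j F G ∶ k) → IsPi p
pi-view (⊩ne R n) with refl ← ⟶*-det done (red R) pi (~-neˡ n) with (_ , ()) ← nfˡ n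
pi-view (⊩sort R _) with () ← ⟶*-det done (red R) pi sort
pi-view (⊩pi R _ _ _) with refl ← ⟶*-det done (red R) pi pi = isPi

⊨-app : ∀ a → Γ ⊨ t ≡ t' ∶ pi a i j U T → Γ ⊨ u ≡ u' ∶[ a ] U → Γ ⊨ app a t u ≡ app a t' u' ∶ T [ u ]
⊨-app {Γ} {t} {t'} {i} {j} {U} {T} {u} {u'} a ⊨t ⊨u = valid go
  where
  go : Sub Δ σ σ' Γ → Sem Δ (app a (subst σ t) (subst σ u)) (app a (subst σ' t') (subst σ' u'))
    (subst σ (T [ u ])) (subst σ' (T [ u ]))
  go {Δ} {σ} {σ'} s with at ⊨t s
  ... | sem p q e h with pi-view p | view p q e
  go {Δ} {σ} {σ'} s | sem (⊩pi R pF pG ext) (⊩pi _ qF qG _) (_ , _ , R' , _ , eF , eG) (_ , _ , _ , _ , _ , _ , _ , h) | isPi | pi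
    with refl ← ⟶*-det done (red R') pi pi =
    sem-resp (cong (λ x → app a x _) (rename-idᶠ (subst σ t))) (cong (λ x → app a x _) (rename-idᶠ (subst σ' t')))
      (ty≐ σ) (ty≐ σ')
      -- The codomain inherits the bound of the function type, which may exceed its own sort `j`;
      -- `Sem` asks for the bound `j`.
      (sem (relevel (pG r αˡ) ℕₚ.≤-refl)
        (relevel (qG r γ') ℕₚ.≤-refl)
        (tyIrrelevance (pG r αˡ) _ refl refl (tyTrans (pG r αˡ) (pG r γʳ) refl (ext r αˡ γ) (eG r γʳ)))
        (irrelevance (pG r αˡ) _ refl refl refl (h r αˡ α)))
    where
    r = id-ren (⊢sub s)
    ty≐ : ∀ σ → rename (liftRen id) (subst (liftSub σ) T) [ subst σ u ] ≐ subst σ (T [ u ])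
    ty≐ σ = trans (rename-lift-id-single (subst σ u) (subst (liftSub σ) T)) (sym (subst-[] σ u T))
    idU : ∀ σ → subst σ U ≐ rename id (subst σ U)
    idU σ = sym (rename-idᶠ _)
    α : Arg a (subst σ U) pF r (subst σ u) (subst σ' u')
    α = semArg a _ _ pF eF r (annSem-resp a refl refl (idU σ) (idU σ') (atᵃ ⊨u s))
    αˡ = argL a (subst σ U) pF r α
    -- The right-hand type is `T [ u ]` under `σ'`, whereas `α` leads to `subst σ' u'`. This
    -- argument steers the type equality to `subst σ' u`.
    γ : Arg a (subst σ U) pF r (subst σ u) (subst σ' u)
    γ = semArg a _ _ pF eF r (annSem-resp a refl refl (idU σ) (idU σ') (atᵃ (⊨ann-reflˡ a ⊨u) s))
    γʳ = argR a (subst σ U) pF r γ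
    γ' = convArg a _ (subst σ' U) pF qF eF r γʳ

ann-at : ∀ a → AnnSem a Γ u u' A B → Γ ⊢ u ∶[ a ] A
ann-at rel h       = ann-rel (lhs (sem-≣ h))
ann-at irr (h , _) = ann-irr (lhs (sem-≣ h))

-- The rule eq-β has no premise on U; the first hypothesis is recovered from a context by ⊨ty-entry.
⊨-β : ∀ a → Γ ⊨ U ≡ U ∶ sort i → (Γ ▸ (a , U)) ⊨ t ≡ t ∶ T → Γ ⊨ u ≡ u ∶[ a ] U →
  Γ ⊨ app a (lam a U t) u ≡ t [ u ] ∶ T [ u ]
⊨-β {Γ} {U} {i} {t} {T} {u} a ⊨U ⊨t ⊨u = valid go
  where
  go : Sub Δ σ σ' Γ → Sem Δ (app a (lam a (subst σ U) (subst (liftSub σ) t)) (subst σ u)) (subst σ' (t [ u ]))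
    (subst σ (T [ u ])) (subst σ' (T [ u ]))
  -- The body is used twice: at the argument, for reducibility of the contractum, and at a fresh
  -- variable, for the typing under the binder that the judgemental β-rule demands.
  go {Δ} {σ} {σ'} s with at ⊨t (sub-∷ a s (atᵃ ⊨u s))
                       | at ⊨t (sub-lift {a = a} ⊨U s)
  ... | h | sem p _ _ h' with sem-resp (sym (subst-lift-single σ _ t)) (sym (subst-single σ' u t))
                              (sym (subst-lift-single σ _ T)) (sym (subst-single σ' u T)) h
  ... | sem q q' e h″ = sem-resp refl refl (sym (subst-[] σ u T)) refl (sem q q' e
    (elExp q (β ◅ done , ⟪ ty-app (ty-lam tt (ty-pi (lhs (univ-≣ (⊨-univ ⊨U s))) (escapeTy p))) uu ,
       lhs (escapeEl q h″) , eq-β tt uu ⟫) h″))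
    where
    tt = lhs (escapeEl p h')
    uu = ann-at a (atᵃ ⊨u s)

ann-conv : Γ ⊢ u ∶[ a ] A → Γ ⊢ A ≡ B ∶ sort k → Γ ⊕ ⊢ A ≡ B ∶ sort l → Γ ⊢ u ∶[ a ] B
ann-conv (ann-rel d) e e⊕ = ann-rel (ty-conv d e)
ann-conv (ann-irr d) e e⊕ = ann-irr (ty-conv d e⊕)

lam-el : ∀ {b b'} (p : Γ ⊩⟨ N ⟩ G [ v ] ∶ k) → Γ ⊢ app a (lam a F b) v ≣ app a (lam a F' b') v' ∶ G [ v ] →
  (Γ ▸ (a , F)) ⊢ b ∶ G → Γ ⊢ v ∶[ a ] F → (Γ ▸ (a , F')) ⊢ b' ∶ G' → Γ ⊢ v' ∶[ a ] F' →
  Sem Γ (b [ v ]) (b' [ v' ]) (G [ v ]) (G' [ v' ]) → El p (app a (lam a F b) v) (app a (lam a F' b') v')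
lam-el p app≣ d x d' x' (sem q _ e h) =
  elExp p (β ◅ done , ⟪ lhs app≣ , lhs body≣ , eq-β d x ⟫)
    (elExpʳ p (β ◅ done , ⟪ rhs app≣ , rhs body≣ , eq-conv (eq-β d' x') (eq-sym (equ (escapeEq q e))) ⟫) h')
  where
  h' = irrelevance q p refl refl refl h
  body≣ = escapeEl p h'

⊨-lam : ∀ a → Γ ⊨ U ≡ U' ∶ sort i → (Γ ▸ (a , U)) ⊨ T ≡ T ∶ sort j → (Γ ▸ (a , U)) ⊨ t ≡ t' ∶ T →
  Γ ⊨ lam a U t ≡ lam a U' t' ∶ pi a i j U T
⊨-lam {Γ} {U} {U'} {i} {T} {j} {t} {t'} a ⊨U ⊨T ⊨t = valid go
  where
  ⊨U₀ : Γ ⊨ U ≡ U ∶ sort i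
  ⊨U₀ = ⊨-reflˡ ⊨U
  go : Sub Δ σ σ' Γ → Sem Δ (lam a (subst σ U) (subst (liftSub σ) t)) (lam a (subst σ' U') (subst (liftSub σ') t'))
    (pi a i j (subst σ U) (subst (liftSub σ) T)) (pi a i j (subst σ' U) (subst (liftSub σ') T))
  go {Δ} {σ} {σ'} s = sem P (proj₁ (proj₂ P≈)) (tyIrrelevance (proj₁ P≈) P refl refl (proj₂ (proj₂ P≈)))
    (_ , _ , ↘-refl (lhs L) , ↘-refl (rhs L) , lam , lam , L , app≈)
    where
    s₀ = sub-reflˡ s
    P≈ = univ-pi ⊨U₀ ⊨T s
    P = piTy ⊨U₀ ⊨T s₀
    pF = piFam ⊨U₀ ⊨T s₀
    pG = piFam₂ ⊨U₀ ⊨T s₀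
    E = univ-≣ (univ-pi ⊨U ⊨T s)
    body≐ : ∀ ρ σ v t → subst ((rename ρ ∘ σ) ∷ˢ v) t ≐ rename (liftRen ρ) (subst (liftSub σ) t) [ v ]
    body≐ ρ σ v t = sym (rename-lift-subst-single ρ σ v t)
    tˡ = lhs (sem-≣ (at ⊨t (sub-lift ⊨U₀ s)))
    tʳ = lhs (sem-≣ (at (⊨-ctx {a = a} ⊨U (⊨-reflʳ ⊨t)) (sub-lift (⊨-reflʳ ⊨U) (sub-reflʳ s))))
    L : Δ ⊢ lam a (subst σ U) (subst (liftSub σ) t) ≣ lam a (subst σ' U') (subst (liftSub σ') t')
          ∶ pi a i j (subst σ U) (subst (liftSub σ) T)
    L = ⟪ ty-lam tˡ (lhs E) , ty-conv (ty-lam tʳ (rhs E)) (eq-sym (equ E)) ,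
          eq-lam (equ (univ-≣ (⊨-univ ⊨U s))) (lhs (univ-≣ (⊨-univ ⊨T (sub-lift ⊨U₀ s))))
            (equ (sem-≣ (at ⊨t (sub-lift ⊨U₀ s)))) ⟫
    app≈ : ∀ {Θ ρ v v'} (r : Ren Θ ρ Δ) (α : Arg a (subst σ U) pF r v v) → Arg a (subst σ U) pF r v v' →
      El (pG r α) (app a (rename ρ (lam a (subst σ U) (subst (liftSub σ) t))) v)
                  (app a (rename ρ (lam a (subst σ' U') (subst (liftSub σ') t'))) v')
    app≈ {_} {ρ} {v} {v'} r α α' = lam-el (pG r α) app≣
      (ren-ty tˡ (under-ty tˡ r)) (annˡ arg≣) (ren-ty tʳ (under-ty tʳ r))
      (ann-conv (annʳ arg≣) (equ (univ-≣ (⊨-univ-ren ⊨U s r))) (equ (univ-≣ (⊨-univ-ren ⊨U s (resurrect r)))))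
      (sem-resp (body≐ ρ σ v t) (body≐ ρ σ' v' t') (body≐ ρ σ v T) (body≐ ρ σ' v' T) (at ⊨t (sub-arg a ⊨U₀ s pF r α')))
      where
      arg≣ = escapeArg a (subst σ U) pF r α'
      app≣ = app-≣ (≣-ren L r) arg≣ (univ-≣ (univ-resp (body≐ ρ σ v T) (body≐ ρ σ v' T)
               (⊨-univ ⊨T (sub-arg a ⊨U₀ s₀ pF r α'))))

η-body : Γ ⊢ t ∶ pi a i j F G → Γ ⊢ F ∶ sort k → (Γ ▸ (a , F)) ⊢ app a (wk t) (var 0) ∶ G
η-body {Γ} {a = a} {F = F} {G = G} d dF = ⊢-ty refl (rename-lift-wk-var0 G) (ty-app (ren-ty d (wk-ren w)) (v0 a w))
  where
  w : ⊢ (Γ ▸ (a , F))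
  w = ctx-▸ (ty-wf d) dF
  v0 : ∀ a → ⊢ (Γ ▸ (a , F)) → (Γ ▸ (a , F)) ⊢ var 0 ∶[ a ] wk F
  v0 rel w = ann-rel (ty-var w here)
  v0 irr w = ann-irr (ty-var (⊢-⊕ w) here)

η-lam : Γ ⊢ t ∶ pi a i j F G → Γ ⊢ F ∶ sort k → Γ ⊢ pi a i j F G ∶ sort l →
  Γ ⊢ t ≣ lam a F (app a (wk t) (var 0)) ∶ pi a i j F G
η-lam d dF dP = ⟪ d , ty-lam (η-body d dF) dP , eq-η d ⟫

-- `El` at a function type compares applications, and an application of the expansion β-reduces to
-- an application of `t`.
⊨-η : ∀ a → Γ ⊨ t ≡ t ∶ pi a i j U T → Γ ⊨ t ≡ lam a U (app a (wk t) (var 0)) ∶ pi a i j U T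
⊨-η {Γ} {t} {i} {j} {U} {T} a ⊨t = valid go
  where
  go : Sub Δ σ σ' Γ → Sem Δ (subst σ t) (lam a (subst σ' U) (app a (subst (liftSub σ') (wk t)) (var 0)))
    (pi a i j (subst σ U) (subst (liftSub σ) T)) (pi a i j (subst σ' U) (subst (liftSub σ') T))
  go {Δ} {σ} {σ'} s with at ⊨t s
  ... | sem p q e h with pi-view p | pi-view q | ≣-sym (escapeEq p e)
  go {Δ} {σ} {σ'} s | sem p@(⊩pi R pF pG ext) q@(⊩pi Q qF _ _) e (f , g , r , r' , ff , fg , t≣ , h) | isPi | isPi | E =
    sem-resp refl (cong (λ x → lam a (subst σ' U) (app a x (var 0))) (sym (wk-subst σ' t))) refl refl
      (sem p q e (f , lam a (subst σ' U) (app a (wk (subst σ' t)) (var 0)) , r , ↘-refl (rhs L) , ff , lam , ≣-trans t≣ L , app≈))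
    where
    L : Δ ⊢ subst σ' t ≣ lam a (subst σ' U) (app a (wk (subst σ' t)) (var 0)) ∶ pi a i j (subst σ U) (subst (liftSub σ) T)
    L = ≣-conv (η-lam (ty-conv (rhs t≣) (eq-sym (equ E))) (famTy {F = subst σ' U} (⊢sub s) qF) (escapeTy q)) E
    app≈ : ∀ {Θ ρ v v'} (w : Ren Θ ρ Δ) (α : Arg a (subst σ U) pF w v v) → Arg a (subst σ U) pF w v v' →
      El (pG w α) (app a (rename ρ (subst σ t)) v)
                  (app a (rename ρ (lam a (subst σ' U) (app a (wk (subst σ' t)) (var 0)))) v')
    app≈ {_} {ρ} {v} {v'} w α α' = elExpʳ (pG w α) (β◅ , ≣-conv (≣-sym app≣) (≣-sym (escapeEq (pG w α) (ext w α α')))) (h w α α')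
      where
      app≣ = app-≣ (≣-ren L w) (annEq-refl (annʳ (escapeArg a (subst σ U) pF w α'))) (≣-refl (rhs (escapeEq (pG w α) (ext w α α'))))
      β◅ : app a (rename ρ (lam a (subst σ' U) (app a (wk (subst σ' t)) (var 0)))) v' ⟶* app a (rename ρ (subst σ' t)) v'
      β◅ = ⟶-resp (cong (λ x → app a x v') (trans (cong _[ v' ] (wk-rename ρ (subst σ' t))) (wk-single v' _))) β ◅ done

-- The fundamental theorem

⊨ty    : Γ ⊢ t ∶ A → Γ ⊨ t ≡ t ∶ A
⊨eq    : Γ ⊢ t ≡ u ∶ A → Γ ⊨ t ≡ u ∶ A
⊨ann   : Γ ⊢ u ∶[ a ] A → Γ ⊨ u ≡ u ∶[ a ] A
⊨eqann : Γ ⊢ u ≡ u' ∶[ a ] A → Γ ⊨ u ≡ u' ∶[ a ] A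
⊨ty-entry  : (Γ ▸ (a , U)) ⊢ t ∶ A → ∃ λ k → Γ ⊨ U ≡ U ∶ sort k
⊨ctx-entry : ⊢ (Γ ▸ (a , U)) → ∃ λ k → Γ ⊨ U ≡ U ∶ sort k
-- `ty-lam` types the whole function type; validity of its components is taken from subderivations,
-- which keeps the recursion structural.
⊨pi-inv : Γ ⊢ pi a i j U T ∶ A → (Γ ⊨ U ≡ U ∶ sort i) × ((Γ ▸ (a , U)) ⊨ T ≡ T ∶ sort j)

⊨ctx-entry (ctx-▸ w d) = _ , ⊨ty d

⊨ty-entry (ty-sort w)   = ⊨ctx-entry w
⊨ty-entry (ty-pi d _)   = ⊨ty-entry d
⊨ty-entry (ty-var w _)  = ⊨ctx-entry w
⊨ty-entry (ty-lam _ d)  = ⊨ty-entry d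
⊨ty-entry (ty-app d _)  = ⊨ty-entry d
⊨ty-entry (ty-conv d _) = ⊨ty-entry d

⊨pi-inv (ty-pi d e)   = ⊨ty d , ⊨ty e
⊨pi-inv (ty-conv d _) = ⊨pi-inv d

⊨ty (ty-sort w)   = ⊨-sort
⊨ty (ty-pi d e)   = ⊨-pi (⊨ty d) (⊨ty e)
⊨ty (ty-var w h)  = ⊨-var h
⊨ty (ty-lam d e)  = let ⊨U , ⊨T = ⊨pi-inv e in ⊨-lam _ ⊨U ⊨T (⊨ty d)
⊨ty (ty-app d e)  = ⊨-app _ (⊨ty d) (⊨ann e)
⊨ty (ty-conv d e) = ⊨-conv (⊨ty d) (⊨eq e)

⊨eq (eq-β d e)     = ⊨-β _ (proj₂ (⊨ty-entry d)) (⊨ty d) (⊨ann e)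
⊨eq (eq-η d)       = ⊨-η _ (⊨ty d)
⊨eq (eq-refl d)    = ⊨ty d
⊨eq (eq-sym d)     = ⊨-sym (⊨eq d)
⊨eq (eq-trans d e) = ⊨-trans (⊨eq d) (⊨eq e)
⊨eq (eq-pi d e)    = ⊨-pi (⊨eq d) (⊨eq e)
⊨eq (eq-lam d e f) = ⊨-lam _ (⊨eq d) (⊨ty e) (⊨eq f)
⊨eq (eq-app d e)   = ⊨-app _ (⊨eq d) (⊨eqann e)
⊨eq (eq-conv d e)  = ⊨-conv (⊨eq d) (⊨eq e)

⊨ann (ann-rel d) = valid λ s → at (⊨ty d) s
⊨ann (ann-irr d) = valid λ s → at (⊨ty d) (sub-⊕ s) , at (⊨ty d) (sub-⊕ (sub-sym s))

⊨eqann (eqann-rel d)   = valid λ s → at (⊨eq d) s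
⊨eqann (eqann-irr d e) = valid λ s → at (⊨ty d) (sub-⊕ s) , at (⊨ty e) (sub-⊕ (sub-sym s))

sub-cod : Δ ≐ Γ → ∀ {Θ} → Sub Δ σ σ' Θ → Sub Γ σ σ' Θ
sub-cod refl s = s

substᵥ : ∀ t → subst var t ≐ t
substᵥ = subst-id (λ _ → refl)

id-sub : ⊢ Γ → Sub Γ var var Γ
id-sub ctx-ε = mkSub ctx-ε (λ ()) (λ ())
id-sub {Γ ▸ (a , T)} (ctx-▸ w d) = sub-cod (cong (λ A → Γ ▸ (a , A)) (substᵥ T))
  (sub-resp (λ { zero → refl ; (suc _) → refl }) (λ { zero → refl ; (suc _) → refl }) (sub-lift (⊨ty d) (id-sub w)))

⊨-sem : ⊢ Γ → Γ ⊨ t ≡ u ∶ A → Sem Γ t u A A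
⊨-sem {t = t} {u} {A} w h = sem-resp (substᵥ t) (substᵥ u) (substᵥ A) (substᵥ A) (at h (id-sub w))

eq-wf : Γ ⊢ t ≡ u ∶ A → ⊢ Γ
eq-wf (eq-β d _) with ctx-▸ w _ ← ty-wf d = w
eq-wf (eq-η d)       = ty-wf d
eq-wf (eq-refl d)    = ty-wf d
eq-wf (eq-sym d)     = eq-wf d
eq-wf (eq-trans d _) = eq-wf d
eq-wf (eq-pi d _)    = eq-wf d
eq-wf (eq-lam d _ _) = eq-wf d
eq-wf (eq-app d _)   = eq-wf d
eq-wf (eq-conv d _)  = eq-wf d

ty-sem : Γ ⊢ t ∶ A → Sem Γ t t A A
ty-sem d = ⊨-sem (ty-wf d) (⊨ty d)

eq-sem : Γ ⊢ t ≡ u ∶ A → Sem Γ t u A A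
eq-sem d = ⊨-sem (eq-wf d) (⊨eq d)

-- Consequences: presuppositions, substitution, injectivity of function types

presup : Γ ⊢ t ≡ u ∶ A → Γ ⊢ t ≣ u ∶ A
presup d = sem-≣ (eq-sem d)

ty-valid : Γ ⊢ t ∶ A → ∃ λ k → Γ ⊢ A ∶ sort k
ty-valid d with ty-sem d
... | sem p _ _ _ = _ , escapeTy p

eq-subst : (Γ ▸ (a , U)) ⊢ t ≡ t' ∶ T → ⊢ Γ → Γ ⊢ u ≡ u' ∶[ a ] U → Γ ⊢ t [ u ] ≡ t' [ u' ] ∶ T [ u ]
eq-subst {a = a} {t = t} {t'} {T} {u} {u'} d w e =
  ⊢-eq (subst-cong (single∷ u) t) (subst-cong (single∷ u') t') (subst-cong (single∷ u) T)
    (equ (sem-≣ (at (⊨eq d) (sub-∷ a (id-sub w) (atᵃ (⊨eqann e) (id-sub w))))))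
  where
  single∷ : ∀ u x → (var ∷ˢ subst var u) x ≐ single u x
  single∷ u zero    = substᵥ u
  single∷ u (suc x) = refl

-- Context conversion is already known for semantic substitutions (`sub-ctx`), so it is read off at
-- the identity substitution.
eq-ctx : Γ ⊢ U ≡ U' ∶ sort i → (Γ ▸ (a , U)) ⊢ t ≡ u ∶ A → (Γ ▸ (a , U')) ⊢ t ≡ u ∶ A
eq-ctx e d = equ (sem-≣ (⊨-sem (ctx-▸ (eq-wf e) (rhs (presup e))) (⊨-ctx (⊨eq e) (⊨eq d))))

ty-ctx : Γ ⊢ U ≡ U' ∶ sort i → (Γ ▸ (a , U)) ⊢ t ∶ A → (Γ ▸ (a , U')) ⊢ t ∶ A
ty-ctx e d = lhs (presup (eq-ctx e (eq-refl d)))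

eq-⊕ : Γ ⊢ t ≡ u ∶ A → Γ ⊕ ⊢ t ≡ u ∶ A
eq-⊕ {t = t} {u} {A} d = ⊢-eq (rename-idᶠ t) (rename-idᶠ u) (rename-idᶠ A) (ren-eq d (resurrect-id (⊢-⊕ (eq-wf d))))

ann-conv' : Γ ⊢ u ∶[ a ] A → Γ ⊢ A ≡ B ∶ sort k → Γ ⊢ u ∶[ a ] B
ann-conv' d e = ann-conv d e (eq-⊕ e)

data Shape (Γ : Ctx) (A : Exp) (k : ℕ) : Set where
  sort  : ∀ j → Γ ⊢ A ↘ sort j ∶ sort k → Shape Γ A k
  pi    : ∀ a i j F G → Γ ⊢ A ↘ pi a i j F G ∶ sort k → Shape Γ A k
  ne    : Γ ⊢ A ↘ K ∶ sort k → Ne K → Shape Γ A k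

shape : Γ ⊢ A ∶ sort k → Shape Γ A k
shape d with sem-sort (ty-sem d)
... | ⊩sort R _ , _    = sort _ R
... | ⊩pi R _ _ _ , _  = pi _ _ _ _ _ R
... | ⊩ne R n , _      = ne R (nfⁿ-ne (proj₂ (nfˡ n)))

record PiEq (Γ : Ctx) (a : Ann) (i j : ℕ) (F G B : Exp) : Set where
  constructor piEq
  field
    {dom cod} : Exp
    redʳ      : B ⟶* pi a i j dom cod
    dom≡      : Γ ⊢ F ≡ dom ∶ sort i
    cod≡      : (Γ ▸ (a , F)) ⊢ G ≡ cod ∶ sort j
open PiEq

-- Reducible equality of function types quantifies over all worlds and arguments: the identity
-- renaming gives the domains, and a reflected fresh variable gives the codomains.
eq-pi-inj : Γ ⊢ A ≡ B ∶ sort k → A ⟶* pi a i j F G → PiEq Γ a i j F G B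
eq-pi-inj d r with sem-sort (eq-sem d)
... | ⊩sort R _ , _ , _ with () ← ⟶*-det r (red R) pi sort
eq-pi-inj d r | ⊩ne R n , _ with refl ← ⟶*-det r (red R) pi (~-neˡ n) with (_ , ()) ← nfˡ n
eq-pi-inj {Γ} {a = a} {F = F} {G} d r | ⊩pi R pF pG _ , _ , F' , G' , R' , _ , eF , eG
  with refl ← ⟶*-det r (red R) pi pi =
  piEq (red R') (⊢-eq (rename-idᶠ F) (rename-idᶠ F') refl (equ (escapeEq (pF (id-ren w)) (eF (id-ren w)))))
    (⊢-eq (rename-lift-wk-var0 G) (rename-lift-wk-var0 G') refl (equ (escapeEq (pG (wk-ren w') α) (eG (wk-ren w') α))))
  where
  w  = eq-wf d
  w' = ctx-▸ {a = a} w (famTy {F = F} w pF)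
  α  = reflectVar (≺-acc _) a F pF w'

eq-sort-inj : Γ ⊢ A ≡ B ∶ sort k → A ⟶* sort j → B ⟶* sort j
eq-sort-inj d r with sem-sort (eq-sem d)
... | ⊩sort R _ , _ , R' with refl ← ⟶*-det r (red R) sort sort = red R'
eq-sort-inj d r | ⊩ne R n , _ with refl ← ⟶*-det r (red R) sort (~-neˡ n) with (_ , ()) ← nfˡ n
eq-sort-inj d r | ⊩pi R _ _ _ , _ with () ← ⟶*-det r (red R) sort pi

-- Type conversion; that the intermediate sorts agree is only known after uniqueness of sorts.
infixl 5 _▻_

data _⊢_⇔_ (Γ : Ctx) (A : Exp) : Exp → Set where
  []  : Γ ⊢ A ⇔ A
  _▻_ : Γ ⊢ A ⇔ B → Γ ⊢ B ≡ C ∶ sort k → Γ ⊢ A ⇔ C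

infix 4 _⊢_⇔_

⇔-trans : Γ ⊢ A ⇔ B → Γ ⊢ B ⇔ C → Γ ⊢ A ⇔ C
⇔-trans c []       = c
⇔-trans c (c' ▻ e) = ⇔-trans c c' ▻ e

⇔-sym : Γ ⊢ A ⇔ B → Γ ⊢ B ⇔ A
⇔-sym []      = []
⇔-sym (c ▻ e) = ⇔-trans ([] ▻ eq-sym e) (⇔-sym c)

ty-⇔ : Γ ⊢ t ∶ A → Γ ⊢ A ⇔ B → Γ ⊢ t ∶ B
ty-⇔ d []      = d
ty-⇔ d (c ▻ e) = ty-conv (ty-⇔ d c) e

eq-⇔ : Γ ⊢ t ≡ u ∶ A → Γ ⊢ A ⇔ B → Γ ⊢ t ≡ u ∶ B
eq-⇔ d []      = d
eq-⇔ d (c ▻ e) = eq-conv (eq-⇔ d c) e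

-- Inversion of typing

inv-sort : Γ ⊢ sort k ∶ A → Γ ⊢ sort (suc k) ⇔ A
inv-sort (ty-sort _)   = []
inv-sort (ty-conv d e) = inv-sort d ▻ e

inv-pi : Γ ⊢ pi a i j U T ∶ A →
  (Γ ⊢ U ∶ sort i) × ((Γ ▸ (a , U)) ⊢ T ∶ sort j) × (Γ ⊢ sort (i ⊔ j) ⇔ A)
inv-pi (ty-pi d e)   = d , e , []
inv-pi (ty-conv d e) = let x , y , z = inv-pi d in x , y , z ▻ e

inv-var : ∀ {x} → Γ ⊢ var x ∶ A → ∃ λ B → (Γ ∋ x ∶ B) × (Γ ⊢ B ⇔ A)
inv-var (ty-var _ h)  = _ , h , []
inv-var (ty-conv d e) = let B , h , c = inv-var d in B , h , c ▻ e

inv-lam : Γ ⊢ lam a U t ∶ A → ∃ λ i → ∃ λ j → ∃ λ T → ∃ λ k →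
  ((Γ ▸ (a , U)) ⊢ t ∶ T) × (Γ ⊢ pi a i j U T ∶ sort k) × (Γ ⊢ pi a i j U T ⇔ A)
inv-lam (ty-lam d e)  = _ , _ , _ , _ , d , e , []
inv-lam (ty-conv d e) = let i , j , T , k , x , y , z = inv-lam d in i , j , T , k , x , y , z ▻ e

inv-app : Γ ⊢ app a t u ∶ A → ∃ λ i → ∃ λ j → ∃ λ U → ∃ λ T →
  (Γ ⊢ t ∶ pi a i j U T) × (Γ ⊢ u ∶[ a ] U) × (Γ ⊢ T [ u ] ⇔ A)
inv-app (ty-app d e)  = _ , _ , _ , _ , d , e , []
inv-app (ty-conv d e) = let i , j , U , T , x , y , z = inv-app d in i , j , U , T , x , y , z ▻ e

ty-pi-valid : Γ ⊢ t ∶ pi a i j F G → (Γ ⊢ F ∶ sort i) × ((Γ ▸ (a , F)) ⊢ G ∶ sort j)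
ty-pi-valid d = let x , y , _ = inv-pi (proj₂ (ty-valid d)) in x , y

⇔-pi : Γ ⊢ F ∶ sort i → (Γ ▸ (a , F)) ⊢ G ∶ sort j → Γ ⊢ pi a i j F G ⇔ B → PiEq Γ a i j F G B
⇔-pi d d' []      = piEq done (eq-refl d) (eq-refl d')
⇔-pi d d' (c ▻ e) with ⇔-pi d d' c
... | piEq r x y with eq-pi-inj e r
... | piEq r' x' y' = piEq r' (eq-trans x x') (eq-trans y (eq-ctx (eq-sym x) y'))

⇔-sort : Γ ⊢ sort j ⇔ B → B ⟶* sort j
⇔-sort []      = done
⇔-sort (c ▻ e) = eq-sort-inj e (⇔-sort c)

-- Uniqueness of types and sorts, subject reduction

∋-det : ∀ {x} → Γ ∋ x ∶ A → Γ ∋ x ∶ B → A ≐ B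
∋-det here      here       = refl
∋-det (there h) (there h') = cong wk (∋-det h h')

var-unique : ∀ {x} → Γ ⊢ var x ∶ A → Γ ⊢ var x ∶ B → Γ ⊢ A ⇔ B
var-unique d d' with inv-var d | inv-var d'
... | _ , h , c | _ , h' , c' with refl ← ∋-det h h' = ⇔-trans (⇔-sym c) c'

app-unique : (∀ {A B} → Γ ⊢ t ∶ A → Γ ⊢ t ∶ B → Γ ⊢ A ⇔ B) → Γ ⊢ app a t u ∶ A → Γ ⊢ app a t u ∶ B → Γ ⊢ A ⇔ B
app-unique unique-t d d' with inv-app d | inv-app d'
... | _ , _ , U , T , x , y , c | _ , _ , U' , T' , x' , y' , c'
  with piEq r e f ← (let p , q = ty-pi-valid x in ⇔-pi p q (unique-t x x'))
  with refl ← ⟶*-det done r pi pi =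
  ⇔-trans (⇔-sym c) (⇔-trans ([] ▻ eq-subst f (ty-wf d) (ann≡-refl y)) c')

ne-unique : Ne t → Γ ⊢ t ∶ A → Γ ⊢ t ∶ B → Γ ⊢ A ⇔ B
ne-unique var     d d' = var-unique d d'
ne-unique (app n) d d' = app-unique (ne-unique n) d d'

-- The only open case is a neutral type, settled by uniqueness of types for neutral terms. That is
-- proved separately because `unique` in general relies on this lemma at abstractions.
sort-unique : Γ ⊢ A ∶ sort k → Γ ⊢ A ∶ sort l → k ≐ l
sort-unique d d' with sem-sort (ty-sem d) | sem-sort (ty-sem d')
... | p , _ | q , _ with view p q (tyRefl p)
sort-unique d d' | ⊩ne R n , _ | ⊩ne R' _ , _ | ne
  with refl ← ⟶*-det done (⇔-sort (ne-unique (nfⁿ-ne (proj₂ (nfˡ n))) (rhs (typ R)) (rhs (typ R')))) sort sort = refl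
sort-unique d d' | _ | _ | sort = refl
sort-unique d d' | _ | _ | pi   = refl

⇔-eq : Γ ⊢ A ∶ sort k → Γ ⊢ A ⇔ B → Γ ⊢ A ≡ B ∶ sort k
⇔-eq d []      = eq-refl d
⇔-eq d (c ▻ e) with e' ← ⇔-eq d c with refl ← sort-unique (rhs (presup e')) (lhs (presup e)) = eq-trans e' e

unique : Γ ⊢ t ∶ A → Γ ⊢ t ∶ B → Γ ⊢ A ⇔ B
unique {t = sort k} d d'       = ⇔-trans (⇔-sym (inv-sort d)) (inv-sort d')
unique {t = pi a i j U T} d d' = ⇔-trans (⇔-sym (proj₂ (proj₂ (inv-pi d)))) (proj₂ (proj₂ (inv-pi d')))
unique {t = var x} d d'        = var-unique d d'
unique {t = app a t u} d d'    = app-unique (unique {t = t}) d d'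
unique {t = lam a U t} d d' with inv-lam d | inv-lam d'
... | _ , _ , T , _ , x , y , c | _ , _ , T' , _ , x' , y' , c' with inv-pi y | inv-pi y'
... | u , v , _ | u' , v' , _
  with e ← ⇔-eq v (unique {t = t} x x')
  -- An abstraction shows no sorts, so the annotations of its two function types must be identified
  -- before `eq-pi` applies.
  with refl ← sort-unique u u' | refl ← sort-unique (rhs (presup e)) v' =
  ⇔-trans (⇔-sym c) (⇔-trans ([] ▻ eq-pi (eq-refl u) e) c')

-- At a β-redex, injectivity of function types carries the argument from the domain in the type of
-- the abstraction to the domain written on it.
subject-reduction : t ⟶ u → Γ ⊢ t ∶ A → Γ ⊢ t ≡ u ∶ A
subject-reduction (appˡ s) d with inv-app d
... | _ , _ , _ , _ , x , y , c = eq-⇔ (eq-app (subject-reduction s x) (ann≡-refl y)) c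
subject-reduction β d with inv-app d
... | _ , _ , _ , _ , x , y , c with inv-lam x
... | _ , _ , _ , _ , x' , y' , c' with inv-pi y'
... | p , q , _ with ⇔-pi p q c'
... | piEq r e f with refl ← ⟶*-det done r pi pi =
  eq-⇔ (eq-conv (eq-β x' y₀) (eq-subst f (ty-wf d) (ann≡-refl y₀))) c
  where y₀ = ann-conv' y (eq-sym e)

subject-reduction* : t ⟶* u → Γ ⊢ t ∶ A → Γ ⊢ t ≡ u ∶ A
subject-reduction* done    d = eq-refl d
subject-reduction* (s ◅ r) d = let e = subject-reduction s d in eq-trans e (subject-reduction* r (rhs (presup e)))

-- Terms with the same normal form are equal

ne-unren : Ne (rename ρ t) → Ne t
ne-unren {t = var x}     _       = var
ne-unren {t = app a t u} (app n) = app (ne-unren n)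

nfⁿ-ne′ : Nfⁿ s t e → Ne e
nfⁿ-ne′ nf-var       = var
nfⁿ-ne′ (nf-app d _) = app (nfⁿ-ne′ d)
nfⁿ-ne′ (nf-appⁱ d)  = app (nfⁿ-ne′ d)

-- Consequently η-contraction produces only neutral terms, and a contracted form never coincides
-- with a sort, a function type or a kept abstraction.
nf-app-ne : Nf s t n → n ≐ app a e e' → Ne n
nf-app-ne (nf-lam _ d contract) _ with app n ← nf-app-ne d refl = ne-unren n
nf-app-ne (nf-ne _ d)           _ = nfⁿ-ne′ d

contract-ne : Nf s t (app a (wk e) u) → Ne e
contract-ne d with app n ← nf-app-ne d refl = ne-unren n

ηView-inj : ∀ {n'} → Nf s t n → Nf s' t' n' → ηView a n m → ηView a n' m → n ≐ n'
ηView-inj d d' contract contract = refl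
ηView-inj d d' contract (keep _) with () ← contract-ne d
ηView-inj d d' (keep _) contract with () ← contract-ne d'
ηView-inj d d' (keep _) (keep _) = refl

-- Domains are erased from normal forms and a contracted form no longer shows its outer annotation,
-- so both are matched through the common type by injectivity.
lam-lam : ∀ {b b' V V'} → t ⟶* lam a V b → t' ⟶* lam a' V' b' → Γ ⊢ t ∶ A → Γ ⊢ t' ∶ A →
  (a ≐ a' → ∀ {T} → (Γ ▸ (a , V)) ⊢ b ∶ T → (Γ ▸ (a , V)) ⊢ b' ∶ T → (Γ ▸ (a , V)) ⊢ b ≡ b' ∶ T) →
  Γ ⊢ t ≡ t' ∶ A
lam-lam r r' d d' body
  with e ← subject-reduction* r d | e' ← subject-reduction* r' d'
  with _ , _ , _ , _ , x , y , c ← inv-lam (rhs (presup e)) | _ , _ , _ , _ , x' , _ , c' ← inv-lam (rhs (presup e'))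
  with p , q , _ ← inv-pi y
  with piEq r″ f g ← ⇔-pi p q (⇔-trans c (⇔-sym c'))
  with refl ← ⟶*-det done r″ pi pi =
  eq-trans e (eq-trans (eq-⇔ (eq-lam f q (body refl x (ty-conv (ty-ctx (eq-sym f) x') (eq-sym g)))) c) (eq-sym e'))

-- The other term is η-expanded over the domain `V` of the abstraction, which leaves a comparison of
-- bodies.
lam-ne : ∀ {b V} → t ⟶* lam a V b → t' ⟶* u → Γ ⊢ t ∶ A → Γ ⊢ t' ∶ A →
  (∀ {T} → (Γ ▸ (a , V)) ⊢ b ∶ T → (Γ ▸ (a , V)) ⊢ app a (wk u) (var 0) ∶ T →
    (Γ ▸ (a , V)) ⊢ b ≡ app a (wk u) (var 0) ∶ T) →
  Γ ⊢ t ≡ t' ∶ A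
lam-ne r r' d d' body
  with e ← subject-reduction* r d | e' ← subject-reduction* r' d'
  with _ , _ , _ , _ , x , y , c ← inv-lam (rhs (presup e))
  with p , q , _ ← inv-pi y
  with k ← ty-⇔ (rhs (presup e')) (⇔-sym c) =
  eq-trans e (eq-trans (eq-⇔ (eq-trans (eq-lam (eq-refl p) q (body x (η-body k p))) (eq-sym (eq-η k))) c) (eq-sym e'))

-- With the slack `z` made explicit, each weight inequality becomes a ring identity for the solver.
below : ∀ {x y} z → y ≐ suc x + z → x < y
below z refl = ℕₚ.m≤m+n _ z

lam-lam-< : ∀ s s' → s + s' < (3 + s) + (3 + s')
lam-lam-< s s' = below 5 (go s s')
  where
  go : ∀ s s' → (3 + s) + (3 + s') ≐ suc (s + s') + 5
  go = solve-∀

lam-ne-< : ∀ a s s' → s + suc (η-size a s') < (3 + s) + suc s'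
-- Slack zero: the body and the expanded neutral term weigh `s + s' + 3` together, so three is the
-- least weight for an abstraction that makes this decrease.
lam-ne-< rel s s' = below 0 (go s s')
  where
  go : ∀ s s' → (3 + s) + suc s' ≐ suc (s + suc (suc (s' + 1))) + 0
  go = solve-∀
lam-ne-< irr s s' = below 1 (go s s')
  where
  go : ∀ s s' → (3 + s) + suc s' ≐ suc (s + suc (suc s')) + 1
  go = solve-∀

ne-lam-< : ∀ a s s' → suc (η-size a s) + s' < suc s + (3 + s')
ne-lam-< rel s s' = below 0 (go s s')
  where
  go : ∀ s s' → suc s + (3 + s') ≐ suc (suc (suc (s + 1)) + s') + 0
  go = solve-∀
ne-lam-< irr s s' = below 1 (go s s')
  where
  go : ∀ s s' → suc s + (3 + s') ≐ suc (suc (suc s) + s') + 1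
  go = solve-∀

left-< : ∀ s₁ s₂ s₁' s₂' → s₁ + s₁' < suc (s₁ + s₂) + suc (s₁' + s₂')
left-< s₁ s₂ s₁' s₂' = below (suc (s₂ + s₂')) (go s₁ s₂ s₁' s₂')
  where
  go : ∀ s₁ s₂ s₁' s₂' → suc (s₁ + s₂) + suc (s₁' + s₂') ≐ suc (s₁ + s₁') + suc (s₂ + s₂')
  go = solve-∀

right-< : ∀ s₁ s₂ s₁' s₂' → s₂ + s₂' < suc (s₁ + s₂) + suc (s₁' + s₂')
right-< s₁ s₂ s₁' s₂' = below (suc (s₁ + s₁')) (go s₁ s₂ s₁' s₂')
  where
  go : ∀ s₁ s₂ s₁' s₂' → suc (s₁ + s₂) + suc (s₁' + s₂') ≐ suc (s₂ + s₂') + suc (s₁ + s₁')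
  go = solve-∀

suc-< : ∀ s s' → s + s' < suc s + suc s'
suc-< s s' = s≤s (ℕₚ.+-monoʳ-≤ s (ℕₚ.n≤1+n s'))

-- Terms in general are compared at a common type. For neutral terms the types may differ and are
-- shown convertible, since the heads of two applications arrive from inversion with unrelated
-- function types.
nf-sound  : Acc _<_ (s + s') → Nf s t n → Nf s' t' n → Γ ⊢ t ∶ A → Γ ⊢ t' ∶ A → Γ ⊢ t ≡ t' ∶ A
nfⁿ-sound : Acc _<_ (s + s') → Nfⁿ s t e → Nfⁿ s' t' e → Γ ⊢ t ∶ A → Γ ⊢ t' ∶ B →
  (Γ ⊢ t ≡ t' ∶ A) × (Γ ⊢ A ⇔ B)

nf-sound (acc rs) (nf-lam {s = s} r x v) (nf-lam {s = s'} r' x' v') d d' =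
  lam-lam r r' d d' λ { refl y y' →
    nf-sound (rs (lam-lam-< s s')) (transport (Nf _ _) (ηView-inj x x' v v') x) x' y y' }
nf-sound (acc rs) (nf-lam {a = a} {s = s} r x contract) (nf-ne {s = s'} r' x') d d' =
  lam-ne r r' d d' (nf-sound (rs (lam-ne-< a s s')) x (nf-ne done (nf-η-arg x')))
nf-sound (acc rs) (nf-ne {s = s} r x) (nf-lam {a = a} {s = s'} r' x' contract) d d' =
  eq-sym (lam-ne r' r d' d λ y y' → eq-sym (nf-sound (rs (ne-lam-< a s s')) (nf-ne done (nf-η-arg x)) x' y' y))
nf-sound _ (nf-lam r x contract) (nf-sort _)   d d' with () ← contract-ne x
nf-sound _ (nf-lam r x contract) (nf-pi _ _ _) d d' with () ← contract-ne x
nf-sound _ (nf-sort _)   (nf-lam r x contract) d d' with () ← contract-ne x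
nf-sound _ (nf-pi _ _ _) (nf-lam r x contract) d d' with () ← contract-ne x
nf-sound _ (nf-sort r) (nf-sort r') d d' = eq-trans (subject-reduction* r d) (eq-sym (subject-reduction* r' d'))
nf-sound (acc rs) (nf-pi {s = s₁} {s' = s₂} r x y) (nf-pi {s = s₁'} {s' = s₂'} r' x' y') d d'
  with e ← subject-reduction* r d | e' ← subject-reduction* r' d'
  with f , g , c ← inv-pi (rhs (presup e)) | f' , g' , _ ← inv-pi (rhs (presup e'))
  with F≡ ← nf-sound (rs (left-< s₁ s₂ s₁' s₂')) x x' f f' =
  eq-trans e (eq-trans (eq-⇔ (eq-pi F≡ (nf-sound (rs (right-< s₁ s₂ s₁' s₂')) y y' g (ty-ctx (eq-sym F≡) g'))) c) (eq-sym e'))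
nf-sound (acc rs) (nf-ne {s = s} r x) (nf-ne {s = s'} r' x') d d'
  with e ← subject-reduction* r d | e' ← subject-reduction* r' d' =
  eq-trans e (eq-trans (proj₁ (nfⁿ-sound (rs (suc-< s s')) x x' (rhs (presup e)) (rhs (presup e')))) (eq-sym e'))

app-sound : ∀ {a} → (∀ {A B} → Γ ⊢ t ∶ A → Γ ⊢ t' ∶ B → (Γ ⊢ t ≡ t' ∶ A) × (Γ ⊢ A ⇔ B)) →
  (∀ {A} → Γ ⊢ u ∶[ a ] A → Γ ⊢ u' ∶[ a ] A → Γ ⊢ u ≡ u' ∶[ a ] A) →
  Γ ⊢ app a t u ∶ A → Γ ⊢ app a t' u' ∶ B → (Γ ⊢ app a t u ≡ app a t' u' ∶ A) × (Γ ⊢ A ⇔ B)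
app-sound head arg d d' with inv-app d | inv-app d'
... | _ , _ , _ , _ , x , y , c | _ , _ , _ , _ , x' , y' , c' with head x x'
... | t≡t' , c″ with piEq r e f ← (let p , q = ty-pi-valid x in ⇔-pi p q c″)
  with refl ← ⟶*-det done r pi pi
  with u≡u' ← arg y (ann-conv' y' (eq-sym e)) =
  eq-⇔ (eq-app t≡t' u≡u') c ,
  ⇔-trans (⇔-sym c) (⇔-trans ([] ▻ eq-subst f (ty-wf d) u≡u') c')

nfⁿ-sound _ nf-var nf-var d d' = let c = var-unique d d' in eq-refl d , c
nfⁿ-sound (acc rs) (nf-app {s = s₁} {s' = s₂} x y) (nf-app {s = s₁'} {s' = s₂'} x' y') =
  app-sound (nfⁿ-sound (rs (left-< s₁ s₂ s₁' s₂')) x x')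
    λ { (ann-rel d) (ann-rel d') → eqann-rel (nf-sound (rs (right-< s₁ s₂ s₁' s₂')) y y' d d') }
nfⁿ-sound (acc rs) (nf-appⁱ {s = s} x) (nf-appⁱ {s = s'} x') =
  app-sound (nfⁿ-sound (rs (suc-< s s')) x x') λ { (ann-irr d) (ann-irr d') → eqann-irr d d' }

-- Decision procedures

common-nf : Γ ⊢ t ≡ u ∶ A → CommonNf t u
common-nf d with eq-sem d
... | sem p _ _ h = reify (≺-acc _) p h

-- The normal forms are those that reification extracts from reflexivity. By `nf-det` they agree
-- with the common one that any proof of equality would provide.
equal? : Γ ⊢ t ∶ A → Γ ⊢ u ∶ A → Dec (Γ ⊢ t ≡ u ∶ A)
equal? d d' with common-nf (eq-refl d) | common-nf (eq-refl d')
... | n , (_ , x) , _ | n' , (_ , x') , _ with n ≟ n'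
... | yes refl = yes (nf-sound (<-wellFounded _) x x' d d')
... | no n≢n'  = no λ e → let _ , (_ , y) , (_ , y') = common-nf e in
  n≢n' (trans (nf-det x y) (nf-det y' x'))

-- By uniqueness of types, any typing at `A` makes `B` and `A` equal in one sort; the sorts are
-- compared beforehand because `equal?` needs a common one.
has-type? : Γ ⊢ t ∶ B → Γ ⊢ A ∶ sort k → Dec (Γ ⊢ t ∶ A)
has-type? {k = k} d dA with ty-valid d
... | l , dB with l ℕₚ.≟ k
... | no l≢k = no λ d' → l≢k (sort-unique (rhs (presup (⇔-eq dB (unique d d')))) dA)
... | yes refl with equal? dB dA
...   | yes e = yes (ty-conv d e)
...   | no ¬e = no λ d' → ¬e (⇔-eq dB (unique d d'))

pi-sort-clash : A ⟶* pi a i j F G → A ⟶* sort k → ⊥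
pi-sort-clash r r' with () ← ⟶*-det r r' pi sort

ne-sort-clash : Ne K → A ⟶* K → A ⟶* sort k → ⊥
ne-sort-clash n r r' with refl ← ⟶*-det r r' (ne n) sort with () ← n

ne-pi-clash : Ne K → A ⟶* K → A ⟶* pi a i j F G → ⊥
ne-pi-clash n r r' with refl ← ⟶*-det r r' (ne n) pi with () ← n

pi-ann : A ⟶* pi a i j F G → A ⟶* pi a' i' j' F' G' → a ≐ a'
pi-ann r r' with refl ← ⟶*-det r r' pi pi = refl

is-type? : Γ ⊢ A ∶ B → Dec (∃ λ k → Γ ⊢ A ∶ sort k)
is-type? {Γ} {A} {B} d = decide (shape (proj₂ (ty-valid d)))
  where
  sort-red : Γ ⊢ A ∶ sort k → B ⟶* sort k
  sort-red d' = ⇔-sort (unique d' d)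
  decide : Shape Γ B l → Dec (∃ λ k → Γ ⊢ A ∶ sort k)
  decide (sort k R)       = yes (k , ty-conv d (equ (typ R)))
  decide (pi a i j F G R) = no λ (_ , d') → pi-sort-clash (red R) (sort-red d')
  decide (ne R n)         = no λ (_ , d') → ne-sort-clash n (red R) (sort-red d')

is-function? : ∀ a → Γ ⊢ t ∶ A → Dec (∃ λ i → ∃ λ j → ∃ λ F → ∃ λ G → Γ ⊢ t ∶ pi a i j F G)
is-function? {Γ} {t} {A} a d = decide (shape (proj₂ (ty-valid d)))
  where
  pi-red : (d' : Γ ⊢ t ∶ pi a i j F G) → PiEq Γ a i j F G A
  pi-red d' = let p , q = ty-pi-valid d' in ⇔-pi p q (unique d' d)
  decide : Shape Γ A l → Dec (∃ λ i → ∃ λ j → ∃ λ F → ∃ λ G → Γ ⊢ t ∶ pi a i j F G)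
  decide (sort k R) = no λ (_ , _ , _ , _ , d') → pi-sort-clash (redʳ (pi-red d')) (red R)
  decide (ne R n)   = no λ (_ , _ , _ , _ , d') → ne-pi-clash n (red R) (redʳ (pi-red d'))
  decide (pi a' i j F G R) with a' ≟ᵃ a
  ... | yes refl = yes (i , j , F , G , ty-conv d (equ (typ R)))
  ... | no a'≢a  = no λ (_ , _ , _ , _ , d') → a'≢a (pi-ann (red R) (redʳ (pi-red d')))

lookup? : ∀ Γ x → Dec (∃ λ A → Γ ∋ x ∶ A)
lookup? ε             x       = no λ ()
lookup? (Γ ▸ (rel , U)) zero  = yes (_ , here)
lookup? (Γ ▸ (irr , U)) zero  = no λ ()
lookup? (Γ ▸ e)       (suc x) with lookup? Γ x
... | yes (_ , h) = yes (_ , there h)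
... | no ¬h       = no λ { (_ , there h) → ¬h (_ , h) }

infer : ⊢ Γ → ∀ t → Dec (∃ λ A → Γ ⊢ t ∶ A)
infer w (sort k) = yes (_ , ty-sort w)
infer {Γ} w (var x) with lookup? Γ x
... | yes (_ , h) = yes (_ , ty-var w h)
... | no ¬h       = no λ (_ , d) → let B , h , _ = inv-var d in ¬h (B , h)
infer w (pi a i j U T) with infer w U
... | no ¬d = no λ (_ , d) → ¬d (_ , proj₁ (inv-pi d))
... | yes (_ , d) with has-type? d (ty-sort {i = i} w)
...   | no ¬d = no λ (_ , d) → ¬d (proj₁ (inv-pi d))
...   | yes dU with infer (ctx-▸ {a = a} w dU) T
...     | no ¬d = no λ (_ , d) → ¬d (_ , proj₁ (proj₂ (inv-pi d)))
...     | yes (_ , d) with has-type? d (ty-sort {i = j} (ty-wf d))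
...       | no ¬d  = no λ (_ , d) → ¬d (proj₁ (proj₂ (inv-pi d)))
...       | yes dT = yes (_ , ty-pi dU dT)
infer w (lam a U t) with infer w U
... | no ¬d = no λ (_ , d) → let _ , _ , _ , _ , _ , y , _ = inv-lam d in ¬d (_ , proj₁ (inv-pi y))
... | yes (_ , d) with is-type? d
...   | no ¬d = no λ (_ , d) → let _ , _ , _ , _ , _ , y , _ = inv-lam d in ¬d (_ , proj₁ (inv-pi y))
...   | yes (_ , dU) with infer (ctx-▸ {a = a} w dU) t
...     | no ¬d = no λ (_ , d) → let _ , _ , _ , _ , x , _ = inv-lam d in ¬d (_ , x)
-- The sort annotations of the inferred type are chosen here: the sort found for `U`, and the one
-- that `ty-valid` gives for the type of the body.
...     | yes (_ , d) = yes (_ , ty-lam d (ty-pi dU (proj₂ (ty-valid d))))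
infer {Γ} w (app a t u) with infer w t
... | no ¬d = no λ (_ , d) → let _ , _ , _ , _ , x , _ = inv-app d in ¬d (_ , x)
... | yes (_ , d) with is-function? a d
...   | no ¬d = no λ (_ , d) → let _ , _ , _ , _ , x , _ = inv-app d in ¬d (_ , _ , _ , _ , x)
...   | yes (_ , _ , F , G , dt) = app-case (argument? a)
  where
  dF = proj₁ (ty-pi-valid dt)
  argument? : ∀ a → Dec (Γ ⊢ u ∶[ a ] F)
  argument? rel with infer w u
  ... | no ¬d = no λ { (ann-rel d) → ¬d (_ , d) }
  ... | yes (_ , d) with has-type? d dF
  ...   | yes d' = yes (ann-rel d')
  ...   | no ¬d  = no λ { (ann-rel d) → ¬d d }
  argument? irr with infer (⊢-⊕ w) u
  ... | no ¬d = no λ { (ann-irr d) → ¬d (_ , d) }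
  ... | yes (_ , d) with has-type? d (lhs (presup (eq-⊕ (eq-refl dF))))
  ...   | yes d' = yes (ann-irr d')
  ...   | no ¬d  = no λ { (ann-irr d) → ¬d d }
  app-case : Dec (Γ ⊢ u ∶[ a ] F) → Dec (∃ λ A → Γ ⊢ app a t u ∶ A)
  app-case (yes du) = yes (_ , ty-app dt du)
  -- Another typing of `t` may have another domain; uniqueness and injectivity convert it to `F`,
  -- where the argument was already refused.
  app-case (no ¬du) = no λ (_ , d) → let _ , _ , _ , _ , x , y , _ = inv-app d
                                         p , q = ty-pi-valid x in
    convert y (⇔-pi p q (unique x dt))
    where
    convert : ∀ {U T i j k l} → Γ ⊢ u ∶[ a ] U → PiEq Γ a i j U T (pi a k l F G) → ⊥
    convert y (piEq r e _) with refl ← ⟶*-det done r pi pi = ¬du (ann-conv' y e)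

context? : ∀ Γ → Dec (⊢ Γ)
context? ε = yes ctx-ε
context? (Γ ▸ (a , T)) with context? Γ
... | no ¬w = no λ { (ctx-▸ w _) → ¬w w }
... | yes w with infer w T
...   | no ¬d = no λ { (ctx-▸ _ d) → ¬d (_ , d) }
...   | yes (_ , d) with is-type? d
...     | yes (_ , d') = yes (ctx-▸ w d')
...     | no ¬d        = no λ { (ctx-▸ _ d) → ¬d (_ , d) }

typed? : ∀ Γ t T → Dec (Γ ⊢ t ∶ T)
typed? Γ t T with context? Γ
... | no ¬w = no λ d → ¬w (ty-wf d)
... | yes w with infer w T
...   | no ¬d = no λ d → ¬d (_ , proj₂ (ty-valid d))
...   | yes (_ , d) with is-type? d
...     | no ¬d = no λ d → ¬d (ty-valid d)
...     | yes (_ , dT) with infer w t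
...       | no ¬d       = no λ d → ¬d (_ , d)
...       | yes (_ , d) = has-type? d dT

equality? : ∀ Γ t t' T → Dec (Γ ⊢ t ≡ t' ∶ T)
equality? Γ t t' T with typed? Γ t T | typed? Γ t' T
... | no ¬d | _       = no λ e → ¬d (lhs (presup e))
... | _     | no ¬d   = no λ e → ¬d (rhs (presup e))
... | yes d | yes d'  = equal? d d'

theorem6p7 : ((Γ : Ctx) (t t' T : Exp) → Dec (Γ ⊢ t ≡ t' ∶ T))
    × ((Γ : Ctx) (t T : Exp) → Dec (Γ ⊢ t ∶ T))
theorem6p7 = equality? , typed?
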